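{- Let $N>1/4$ be a rational number, and let $\mathcal{E}_N$ be the elliptic curve over $\mathbb{Q}$ given by $v^2=u^3+2(2N^2+2N-1)u^2-(4N-1)u$. If $\mathcal{E}_N$ has positive rank (over $\mathbb{Q}$), then there are infinitely many rational and integer triangles with $R/r=N$.
   Context: A rational (respectively integer) triangle is a non-degenerate triangle whose side lengths $f,g,h$ are rational numbers (respectively integers). $R$ denotes the radius of its circumcircle and $r$ the radius of the excircle touching the side $h$ from outside (tangent to the side $h$ and to the extensions of the sides $f$ and $g$); explicitly $\frac{R}{r}=\frac{2fgh}{(f+g+h)(f-g-h)(g-h-f)}$. -}

module Defs where

open import Algebra.Bundles.Raw using (RawMonoid)
import Algebra.Definitions.RawMonoid as RawMonoidDefinitions
open import Data.Empty using (⊥-elim)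
open import Data.Fin.Base using (Fin)
open import Data.Integer.Base as ℤ using (ℤ; +_; -[1+_]; 0ℤ)
open import Data.List.Base using (List; []; _∷_; map)
open import Data.List.Relation.Binary.Permutation.Propositional using (_↭_)
open import Data.Nat.Base as ℕ using (ℕ; suc)
open import Data.Product.Base using (Σ; ∃; _×_; _,_)
open import Data.Rational.Base
open import Data.Rational.Properties
open import Data.Rational.Solver using (module +-*-Solver)
open import Function.Definitions using (Injective)
open import Relation.Binary.PropositionalEquality
open import Relation.Nullary.Decidable using (yes; no)

open +-*-Solver using (solve; _:=_; _:+_; _:*_; _:-_; :-_; con)
open ≡-Reasoning

2ℚ 3ℚ 4ℚ : ℚ
2ℚ = + 2 / 1
3ℚ = + 3 / 1
4ℚ = + 4 / 1

private
  x-y≡0⇒x≡y : ∀ x y → x - y ≡ 0ℚ → x ≡ y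
  x-y≡0⇒x≡y x y eq = begin
    x            ≡⟨ solve 2 (λ x y → x := (x :- y) :+ y) refl x y ⟩
    (x - y) + y  ≡⟨ cong (λ z → z + y) eq ⟩
    0ℚ + y       ≡⟨ +-identityˡ y ⟩
    y            ∎

  x≡y⇒x-y≡0 : ∀ {x y} → x ≡ y → x - y ≡ 0ℚ
  x≡y⇒x-y≡0 {x} refl = +-inverseʳ x

  x≢y⇒y-x≢0 : ∀ {x y} → x ≢ y → y - x ≢ 0ℚ
  x≢y⇒y-x≢0 {x} {y} x≢y eq = x≢y (sym (x-y≡0⇒x≡y y x eq))

  *-cancel-0 : ∀ p q → p ≢ 0ℚ → p * q ≡ 0ℚ → q ≡ 0ℚ
  *-cancel-0 p q p≢0 eq = begin
    q               ≡⟨ *-identityˡ q ⟨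
    1ℚ * q          ≡⟨ cong (_* q) (*-inverseˡ p) ⟨
    (1/ p) * p * q  ≡⟨ *-assoc (1/ p) p q ⟩
    1/ p * (p * q)  ≡⟨ cong (1/ p *_) eq ⟩
    1/ p * 0ℚ       ≡⟨ *-zeroʳ (1/ p) ⟩
    0ℚ              ∎
    where instance _ = ≢-nonZero p≢0

  ÷-*-cancel : ∀ p q .{{_ : NonZero q}} → (p ÷ q) * q ≡ p
  ÷-*-cancel p q = begin
    p * 1/ q * q    ≡⟨ *-assoc p (1/ q) q ⟩
    p * (1/ q * q)  ≡⟨ cong (p *_) (*-inverseˡ q) ⟩
    p * 1ℚ          ≡⟨ *-identityʳ p ⟩
    p               ∎

------------------------------------------------------------------------
-- Curves v² = u³ + a u² + b u and the chord-tangent law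

record Curve : Set where
  constructor curve
  field
    a b : ℚ

module _ (E : Curve) where
  open Curve E

  cubic : ℚ → ℚ
  cubic u = u * u * u + a * (u * u) + b * u

  cubic′ : ℚ → ℚ
  cubic′ u = 3ℚ * (u * u) + 2ℚ * a * u + b

  OnCurve : ℚ → ℚ → Set
  OnCurve u v = v * v ≡ cubic u

  -- The proof is irrelevant, so _≡_ on points is equality of coordinates.
  data Point : Set where
    O      : Point
    affine : (u v : ℚ) → .(OnCurve u v) → Point

  -- The line of slope s through (u₁ , v₁) meets the curve again over
  -- thirdU; the sum is the reflection of that third intersection point.
  thirdU : (s u₁ u₂ : ℚ) → ℚ
  thirdU s u₁ u₂ = s * s - a - u₁ - u₂

  sumV : (s u₁ v₁ u₃ : ℚ) → ℚ
  sumV s u₁ v₁ u₃ = s * (u₁ - u₃) - v₁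

  chordSlope : (u₁ v₁ u₂ v₂ : ℚ) → u₁ ≢ u₂ → ℚ
  chordSlope u₁ v₁ u₂ v₂ u₁≢u₂ = (v₂ - v₁) ÷ (u₂ - u₁)
    where instance _ = ≢-nonZero (x≢y⇒y-x≢0 u₁≢u₂)

  tangentSlope : (u v : ℚ) → .(2ℚ * v ≢ 0ℚ) → ℚ
  tangentSlope u v 2v≢0 = _÷_ (cubic′ u) (2ℚ * v) {{≢-nonZero 2v≢0}}

  private
    chord-closed : ∀ s u₁ v₁ u₂ v₂ → u₁ ≢ u₂ → s * (u₂ - u₁) ≡ v₂ - v₁ →
                   OnCurve u₁ v₁ → OnCurve u₂ v₂ →
                   let u₃ = thirdU s u₁ u₂ in OnCurve u₃ (sumV s u₁ v₁ u₃)
    chord-closed s u₁ v₁ u₂ v₂ u₁≢u₂ slope on₁ on₂ =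
      x-y≡0⇒x≡y _ _ (*-cancel-0 (u₂ - u₁) _ (x≢y⇒y-x≢0 u₁≢u₂) (begin
        (u₂ - u₁) * (w * w - cubic u₃)
          ≡⟨ solve 6 (λ s u₁ v₁ u₂ a b →
               let F = λ u → u :* u :* u :+ a :* (u :* u) :+ b :* u
                   u₃ = s :* s :- a :- u₁ :- u₂
                   w = s :* (u₁ :- u₃) :- v₁
                   v₂ = v₁ :+ s :* (u₂ :- u₁) in
               (u₂ :- u₁) :* (w :* w :- F u₃) :=
               (u₂ :- u₃) :* (v₁ :* v₁ :- F u₁) :+ (u₃ :- u₁) :* (v₂ :* v₂ :- F u₂))
               refl s u₁ v₁ u₂ a b ⟩
        (u₂ - u₃) * (v₁ * v₁ - cubic u₁) + (u₃ - u₁) * (v₂′ * v₂′ - cubic u₂)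
          ≡⟨ cong (λ v → (u₂ - u₃) * (v₁ * v₁ - cubic u₁) + (u₃ - u₁) * (v * v - cubic u₂)) v₂′≡v₂ ⟩
        (u₂ - u₃) * (v₁ * v₁ - cubic u₁) + (u₃ - u₁) * (v₂ * v₂ - cubic u₂)
          ≡⟨ cong₂ (λ x y → (u₂ - u₃) * x + (u₃ - u₁) * y) (x≡y⇒x-y≡0 on₁) (x≡y⇒x-y≡0 on₂) ⟩
        (u₂ - u₃) * 0ℚ + (u₃ - u₁) * 0ℚ
          ≡⟨ cong₂ _+_ (*-zeroʳ (u₂ - u₃)) (*-zeroʳ (u₃ - u₁)) ⟩
        0ℚ ∎))
      where
      u₃ = thirdU s u₁ u₂
      w = sumV s u₁ v₁ u₃
      v₂′ = v₁ + s * (u₂ - u₁)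
      v₂′≡v₂ : v₂′ ≡ v₂
      v₂′≡v₂ = trans (cong (λ x → v₁ + x) slope)
                     (solve 2 (λ x y → x :+ (y :- x) := y) refl v₁ v₂)

    tangent-closed : ∀ s u v → s * (2ℚ * v) ≡ cubic′ u → OnCurve u v →
                     let u₃ = thirdU s u u in OnCurve u₃ (sumV s u v u₃)
    tangent-closed s u v slope on = x-y≡0⇒x≡y _ _ (begin
      w * w - cubic u₃
        ≡⟨ solve 5 (λ s u v a b →
             let F = λ u → u :* u :* u :+ a :* (u :* u) :+ b :* u
                 F′ = con 3ℚ :* (u :* u) :+ con 2ℚ :* a :* u :+ b
                 u₃ = s :* s :- a :- u :- u
                 w = s :* (u :- u₃) :- v in
             w :* w :- F u₃ :=
             (v :* v :- F u) :+ (u₃ :- u) :* (s :* (con 2ℚ :* v) :- F′))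
             refl s u v a b ⟩
      (v * v - cubic u) + (u₃ - u) * (s * (2ℚ * v) - cubic′ u)
        ≡⟨ cong₂ (λ x y → x + (u₃ - u) * y) (x≡y⇒x-y≡0 on) (x≡y⇒x-y≡0 slope) ⟩
      0ℚ + (u₃ - u) * 0ℚ
        ≡⟨ cong (λ x → 0ℚ + x) (*-zeroʳ (u₃ - u)) ⟩
      0ℚ ∎)
      where
      u₃ = thirdU s u u
      w = sumV s u v u₃

    same-u⇒2v≢0 : ∀ {u₁ v₁ u₂ v₂} → u₁ ≡ u₂ → v₁ ≢ - v₂ →
                  OnCurve u₁ v₁ → OnCurve u₂ v₂ → 2ℚ * v₁ ≢ 0ℚ
    same-u⇒2v≢0 {u₁} {v₁} {u₂} {v₂} refl v₁≢-v₂ on₁ on₂ 2v₁≡0 =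
      v₁≢-v₂ (x-y≡0⇒x≡y v₁ (- v₂) (begin
        v₁ - (- v₂)         ≡⟨ cong (λ x → v₁ - (- x)) (sym v₁≡v₂) ⟩
        v₁ - (- v₁)         ≡⟨ solve 1 (λ x → x :- (:- x) := con 2ℚ :* x) refl v₁ ⟩
        2ℚ * v₁             ≡⟨ 2v₁≡0 ⟩
        0ℚ                  ∎))
      where
      v₁≡v₂ : v₁ ≡ v₂
      v₁≡v₂ = x-y≡0⇒x≡y v₁ v₂
        (*-cancel-0 (v₁ - (- v₂)) (v₁ - v₂)
          (λ eq → v₁≢-v₂ (x-y≡0⇒x≡y v₁ (- v₂) eq))
          (trans (solve 2 (λ x y → (x :- (:- y)) :* (x :- y) := x :* x :- y :* y) refl v₁ v₂)
                 (x≡y⇒x-y≡0 (trans on₁ (sym on₂)))))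

    neg-closed : ∀ u v → OnCurve u v → OnCurve u (- v)
    neg-closed u v on = trans (solve 1 (λ v → (:- v) :* (:- v) := v :* v) refl v) on

  infixl 6 _⊕_
  infix  8 ⊖_

  ⊖_ : Point → Point
  ⊖ O             = O
  ⊖ affine u v on = affine u (- v) (neg-closed u v on)

  _⊕_ : Point → Point → Point
  O ⊕ Q = Q
  P ⊕ O = P
  affine u₁ v₁ on₁ ⊕ affine u₂ v₂ on₂ with u₁ ≟ u₂
  ... | no u₁≢u₂ =
    let s  = chordSlope u₁ v₁ u₂ v₂ u₁≢u₂
        u₃ = thirdU s u₁ u₂
    in affine u₃ (sumV s u₁ v₁ u₃)
         (chord-closed s u₁ v₁ u₂ v₂ u₁≢u₂
           (÷-*-cancel (v₂ - v₁) (u₂ - u₁) {{≢-nonZero (x≢y⇒y-x≢0 u₁≢u₂)}}) on₁ on₂)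
  ... | yes u₁≡u₂ with v₁ ≟ - v₂
  ...   | yes _ = O
  ...   | no v₁≢-v₂ =
    let s  = tangentSlope u₁ v₁ (same-u⇒2v≢0 u₁≡u₂ v₁≢-v₂ on₁ on₂)
        u₃ = thirdU s u₁ u₁
    in affine u₃ (sumV s u₁ v₁ u₃)
         (tangent-closed s u₁ v₁
           (÷-*-cancel (cubic′ u₁) (2ℚ * v₁)
             {{≢-nonZero (same-u⇒2v≢0 u₁≡u₂ v₁≢-v₂ on₁ on₂)}}) on₁)

  rawMonoid : RawMonoid _ _
  rawMonoid = record { Carrier = Point ; _≈_ = _≡_ ; _∙_ = _⊕_ ; ε = O }

  open RawMonoidDefinitions rawMonoid using (sum) renaming (_×_ to _ℕ·_)

  infixr 8 _·_

  _·_ : ℤ → Point → Point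
  (+ n)    · P = n ℕ· P
  -[1+ n ] · P = ⊖ (suc n ℕ· P)

  Independent : ∀ {n} → (Fin n → Point) → Set
  Independent {n} P =
    (c : Fin n → ℤ) → sum (λ i → c i · P i) ≡ O → ∀ i → c i ≡ 0ℤ

  -- The rank of the group of rational points: the maximal size of a
  -- ℤ-linearly independent family.
  HasRank : ℕ → Set
  HasRank r = Σ (Fin r → Point) Independent
            × (∀ {n} (P : Fin n → Point) → Independent P → n ℕ.≤ r)

  HasPositiveRank : Set
  HasPositiveRank = ∃ λ r → 0 ℕ.< r × HasRank r

-- The discriminant of this cubic is 256 N³ (N + 2) (4 N - 1)², so the curve
-- is nonsingular for every N > 1/4.
𝓔 : ℚ → Curve
𝓔 N = curve (2ℚ * (2ℚ * (N * N) + 2ℚ * N - 1ℚ)) (- (4ℚ * N - 1ℚ))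

------------------------------------------------------------------------
-- Triangles

record RationalTriangle : Set where
  field
    f g h : ℚ
    0<f   : 0ℚ < f
    0<g   : 0ℚ < g
    0<h   : 0ℚ < h
    f<g+h : f < g + h
    g<h+f : g < h + f
    h<f+g : h < f + g

  sides : List ℚ
  sides = f ∷ g ∷ h ∷ []

  ratioDenominator : ℚ
  ratioDenominator = (f + g + h) * (f - g - h) * (g - h - f)

  private
    x<y+z⇒x-y-z<0 : ∀ {x y z} → x < y + z → x - y - z < 0ℚ
    x<y+z⇒x-y-z<0 {x} {y} {z} x<y+z =
      subst₂ _<_
        (solve 3 (λ x y z → x :+ (:- (y :+ z)) := x :- y :- z) refl x y z)
        (+-inverseʳ (y + z))
        (+-monoˡ-< (- (y + z)) x<y+z)

  ratioDenominator-positive : Positive ratioDenominator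
  ratioDenominator-positive =
    subst Positive
      (sym (*-assoc (f + g + h) (f - g - h) (g - h - f)))
      (pos*pos⇒pos (f + g + h) {{pos₁}} ((f - g - h) * (g - h - f)) {{pos₂}})
    where
    pos₁ : Positive (f + g + h)
    pos₁ = positive (+-mono-< (+-mono-< 0<f 0<g) 0<h)
    pos₂ : Positive ((f - g - h) * (g - h - f))
    pos₂ = neg*neg⇒pos (f - g - h) {{negative (x<y+z⇒x-y-z<0 f<g+h)}}
                       (g - h - f) {{negative (x<y+z⇒x-y-z<0 g<h+f)}}

  -- Circumradius over the radius of the excircle touching the side h.
  R/r : ℚ
  R/r = _÷_ (2ℚ * f * g * h) ratioDenominator
          {{pos⇒nonZero ratioDenominator {{ratioDenominator-positive}}}}

open RationalTriangle public using (sides; R/r)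

IsInteger : ℚ → Set
IsInteger q = ∃ λ (z : ℤ) → q ≡ z / 1

IsIntegerTriangle : RationalTriangle → Set
IsIntegerTriangle T = IsInteger f × IsInteger g × IsInteger h
  where open RationalTriangle T

-- Similarity of triangles, irrespective of the labelling of the sides.
_∼_ : RationalTriangle → RationalTriangle → Set
T ∼ T′ = ∃ λ k → 0ℚ < k × map (k *_) (sides T) ↭ sides T′

-- Since R/r is invariant under scaling, triangles are counted up to
-- similarity: there is a sequence of pairwise non-similar ones.
InfinitelyManyTriangles : (RationalTriangle → Set) → Set
InfinitelyManyTriangles Prop =
  Σ (ℕ → RationalTriangle) λ T → (∀ n → Prop (T n)) × Injective _≡_ _∼_ T

{-# OPTIONS --safe #-}
module Submission where

-- Adding P is injective on points unless P is 2-torsion, because P and P + Q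
-- determine the slope of the line through P and Q. Hence the multiples of a
-- point of infinite order are distinct, without recourse to associativity.
-- A point (u , v) gives a solution f : g : h of the equation for R/r; with
-- z = f + g - h and xy = (g + h - f)(h + f - g) one finds z = α m and xy = β m
-- with α, β > 0, so that, unless m = 0, either f, g, h is a triangle or it
-- becomes one after a change of sign and an exchange of two sides.
-- A triangle is similar to the one of only finitely many points, since these
-- have their ratios f : g : h among the ratios of its sides with signs, and
-- f : g : h determines (u , v). So one can always choose a further multiple
-- whose triangle is not similar to those already chosen.

open import Defs
import Algebra.Definitions.RawMonoid as RawMonoidDefinitions
open import Algebra.Properties.Group using (x∙y⁻¹≈ε⇒x≈y)
open import Data.Empty using (⊥-elim)
open import Data.Fin.Base using (zero; suc)
open import Data.Integer.Base as ℤ using (ℤ; +_; -[1+_]; 0ℤ)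
open import Data.Nat.Base as ℕ using (ℕ; zero; suc)
import Data.Nat.Properties as ℕ
open import Data.Bool.Base using (Bool; true; false)
import Data.Integer.Properties as ℤ
open import Data.Nat.Coprimality using (1-coprimeTo) renaming (sym to coprime-sym)
open import Data.List.Base using (List; []; _∷_; _++_; map; concatMap; cartesianProduct)
open import Data.List.Membership.Propositional using (_∈_; lose)
open import Data.List.Membership.Propositional.Properties
open import Data.List.Relation.Binary.Permutation.Propositional using (↭-sym)
open import Data.List.Relation.Binary.Permutation.Propositional.Properties using (∈-resp-↭)
open import Data.List.Relation.Unary.Any using (here; there)
open import Data.Rational.Unnormalised.Base using (mkℚᵘ; *≡*)
open import Data.Sum.Base using (_⊎_; inj₁; inj₂)
open import Data.Product.Base using (Σ; ∃; _×_; _,_; proj₁; proj₂)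
open import Data.Rational.Base
open import Data.Rational.Properties
open import Data.Rational.Solver using (module +-*-Solver)
open import Function.Definitions using (Injective)
open import Relation.Binary.Definitions using (Tri; tri<; tri≈; tri>)
open import Relation.Binary.PropositionalEquality
open import Relation.Nullary.Decidable using (Dec; yes; no; recompute; _×-dec_; ¬?)
open import Relation.Nullary.Negation using (¬_; contradiction)

open +-*-Solver using (solve; _:=_; _:+_; _:*_; _:-_; :-_; con)
open ≡-Reasoning

-- Cancellation in ℚ.

p-q≡0⇒p≡q : ∀ p q → p - q ≡ 0ℚ → p ≡ q
p-q≡0⇒p≡q = x∙y⁻¹≈ε⇒x≈y +-0-group

p≡q⇒p-q≡0 : ∀ {p q} → p ≡ q → p - q ≡ 0ℚ
p≡q⇒p-q≡0 {p} refl = +-inverseʳ p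

p≢q⇒q-p≢0 : ∀ {p q} → p ≢ q → q - p ≢ 0ℚ
p≢q⇒q-p≢0 {p} {q} p≢q eq = p≢q (sym (p-q≡0⇒p≡q q p eq))

p*q≡0⇒q≡0 : ∀ {p q} → p ≢ 0ℚ → p * q ≡ 0ℚ → q ≡ 0ℚ
p*q≡0⇒q≡0 {p} {q} p≢0 eq = begin
  q               ≡⟨ *-identityˡ q ⟨
  1ℚ * q          ≡⟨ cong (_* q) (*-inverseˡ p) ⟨
  (1/ p) * p * q  ≡⟨ *-assoc (1/ p) p q ⟩
  1/ p * (p * q)  ≡⟨ cong (1/ p *_) eq ⟩
  1/ p * 0ℚ       ≡⟨ *-zeroʳ (1/ p) ⟩
  0ℚ              ∎
  where instance _ = ≢-nonZero p≢0

*-cancelˡ-≢0 : ∀ {r p q} → r ≢ 0ℚ → r * p ≡ r * q → p ≡ q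
*-cancelˡ-≢0 {r} {p} {q} r≢0 eq = p-q≡0⇒p≡q p q (p*q≡0⇒q≡0 r≢0 (trans
  (solve 3 (λ r p q → r :* (p :- q) := r :* p :- r :* q) refl r p q) (p≡q⇒p-q≡0 eq)))

÷-*-cancel : ∀ p q .{{_ : NonZero q}} → (p ÷ q) * q ≡ p
÷-*-cancel p q = begin
  p * 1/ q * q    ≡⟨ *-assoc p (1/ q) q ⟩
  p * (1/ q * q)  ≡⟨ cong (p *_) (*-inverseˡ q) ⟩
  p * 1ℚ          ≡⟨ *-identityʳ p ⟩
  p               ∎

p≢-p⇒2*p≢0 : ∀ {p} → p ≢ - p → 2ℚ * p ≢ 0ℚ
p≢-p⇒2*p≢0 {p} p≢-p eq = p≢-p (p-q≡0⇒p≡q p (- p) (trans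
  (solve 1 (λ p → p :- (:- p) := con 2ℚ :* p) refl p) eq))

-- Cancellation for the chord-tangent law.

module _ (E : Curve) where
  open Curve E

  -- A line of slope s through (u₁ , v₁) and (u₂ , v₂) whose third intersection
  -- with the curve is (u₃ , - v₃). In divided-slope all denominators of the
  -- chord slope from (u₁ , v₁) to (u₃ , - v₃) are cleared, so that it also
  -- makes sense, and determines s, when these two points coincide.
  record Secant (u₁ v₁ u₂ v₂ u₃ v₃ : ℚ) : Set where
    field
      s             : ℚ
      on-line       : v₂ ≡ v₁ + s * (u₂ - u₁)
      third         : u₃ ≡ thirdU E s u₁ u₂
      reflected     : v₃ ≡ sumV E s u₁ v₁ u₃
      divided-slope : s * (v₁ - v₃) ≡ u₁ * u₁ + u₁ * u₃ + u₃ * u₃ + a * (u₁ + u₃) + b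

  secant-of-chord : ∀ s u₁ v₁ u₂ v₂ → u₁ ≢ u₂ → s * (u₂ - u₁) ≡ v₂ - v₁ →
                    OnCurve E u₁ v₁ → OnCurve E u₂ v₂ →
                    let u₃ = thirdU E s u₁ u₂ in
                    Secant u₁ v₁ u₂ v₂ u₃ (sumV E s u₁ v₁ u₃)
  secant-of-chord s u₁ v₁ u₂ v₂ u₁≢u₂ slope on₁ on₂ = record
    { s = s
    ; on-line = v₂≡
    ; third = refl
    ; reflected = refl
    -- Multiplied by `u₂ - u₁`, the defect of this equation becomes the difference of the defects of
    -- the two curve equations.
    ; divided-slope = p-q≡0⇒p≡q _ _ (p*q≡0⇒q≡0 u₂-u₁≢0 (trans
        (solve 6 (λ s u₁ v₁ u₂ a b →
               let F = λ u → u :* u :* u :+ a :* (u :* u) :+ b :* u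
                   u₃ = s :* s :- a :- u₁ :- u₂
                   w = s :* (u₁ :- u₃) :- v₁
                   v₂ = v₁ :+ s :* (u₂ :- u₁) in
               (u₂ :- u₁) :* (s :* (v₁ :- w) :- (u₁ :* u₁ :+ u₁ :* u₃ :+ u₃ :* u₃ :+ a :* (u₁ :+ u₃) :+ b)) :=
               (v₂ :* v₂ :- F u₂) :- (v₁ :* v₁ :- F u₁))
               refl s u₁ v₁ u₂ a b)
        (cong₂ _-_ (p≡q⇒p-q≡0 (trans (cong (λ v → v * v) (sym v₂≡)) on₂)) (p≡q⇒p-q≡0 on₁))))
    }
    where
    v₂≡ : v₂ ≡ v₁ + s * (u₂ - u₁)
    v₂≡ = trans (solve 2 (λ x y → y := x :+ (y :- x)) refl v₁ v₂) (cong (λ x → v₁ + x) (sym slope))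
    u₂-u₁≢0 : u₂ - u₁ ≢ 0ℚ
    u₂-u₁≢0 = p≢q⇒q-p≢0 u₁≢u₂

  secant-of-tangent : ∀ s u v → s * (2ℚ * v) ≡ cubic′ E u →
                      let u₃ = thirdU E s u u in
                      Secant u v u v u₃ (sumV E s u v u₃)
  secant-of-tangent s u v slope = record
    { s = s
    ; on-line = solve 3 (λ s u v → v := v :+ s :* (u :- u)) refl s u v
    ; third = refl
    ; reflected = refl
    ; divided-slope = p-q≡0⇒p≡q _ _ (trans
        (solve 5 (λ s u v a b →
               let u₃ = s :* s :- a :- u :- u
                   w = s :* (u :- u₃) :- v in
               s :* (v :- w) :- (u :* u :+ u :* u₃ :+ u₃ :* u₃ :+ a :* (u :+ u₃) :+ b) :=
               s :* (con 2ℚ :* v) :- (con 3ℚ :* (u :* u) :+ con 2ℚ :* a :* u :+ b))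
               refl s u v a b)
        (p≡q⇒p-q≡0 slope))
    }

  -- The slope determines `u₂` through `third` and then `v₂` through `on-line`. Comparing
  -- `reflected` and `divided-slope` for two slopes gives `(s - s′) * (u₁ - u₃) ≡ 0` and
  -- `(s - s′) * (v₁ - v₃) ≡ 0`. If the slopes differed, the sum would be `(u₁ , v₁)` itself, and
  -- `reflected` would force `v₁ ≡ - v₁`.
  Secant-unique : ∀ {u₁ v₁ u₂ v₂ u₂′ v₂′ u₃ v₃} → v₁ ≢ - v₁ →
                  Secant u₁ v₁ u₂ v₂ u₃ v₃ → Secant u₁ v₁ u₂′ v₂′ u₃ v₃ →
                  u₂ ≡ u₂′ × v₂ ≡ v₂′
  Secant-unique {u₁} {v₁} {u₂} {v₂} {u₂′} {v₂′} {u₃} {v₃} v₁≢-v₁ S S′ = by-slopes (s ≟ s′)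
    where
    open Secant S
    open Secant S′ using () renaming
      (s to s′; on-line to on-line′; third to third′; reflected to reflected′; divided-slope to divided-slope′)
    second : ∀ s {u} → u₃ ≡ thirdU E s u₁ u → u ≡ s * s - a - u₁ - u₃
    second s {u} refl = solve 4 (λ s a u₁ u → u := s :* s :- a :- u₁ :- (s :* s :- a :- u₁ :- u)) refl s a u₁ u
    first-factor : (s - s′) * (u₁ - u₃) ≡ 0ℚ
    first-factor = trans
      (solve 5 (λ s s′ u₁ u₃ v₁ → (s :- s′) :* (u₁ :- u₃) := (s :* (u₁ :- u₃) :- v₁) :- (s′ :* (u₁ :- u₃) :- v₁)) refl s s′ u₁ u₃ v₁)
      (p≡q⇒p-q≡0 (trans (sym reflected) reflected′))
    second-factor : (s - s′) * (v₁ - v₃) ≡ 0ℚ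
    second-factor = trans
      (solve 4 (λ s s′ v₁ v₃ → (s :- s′) :* (v₁ :- v₃) := s :* (v₁ :- v₃) :- s′ :* (v₁ :- v₃)) refl s s′ v₁ v₃)
      (p≡q⇒p-q≡0 (trans divided-slope (sym divided-slope′)))
    equal : s ≡ s′ → u₂ ≡ u₂′ × v₂ ≡ v₂′
    equal s≡s′ = u₂≡u₂′ , trans on-line (trans (cong₂ (λ s u → v₁ + s * (u - u₁)) s≡s′ u₂≡u₂′) (sym on-line′))
      where
      u₂≡u₂′ : u₂ ≡ u₂′
      u₂≡u₂′ = trans (second s third) (trans (cong (λ s → s * s - a - u₁ - u₃) s≡s′) (sym (second s′ third′)))
    by-slopes : Dec (s ≡ s′) → u₂ ≡ u₂′ × v₂ ≡ v₂′
    by-slopes (yes s≡s′) = equal s≡s′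
    by-slopes (no s≢s′) = ⊥-elim (v₁≢-v₁ (begin
      v₁                   ≡⟨ v₁≡v₃ ⟩
      v₃                   ≡⟨ reflected ⟩
      s * (u₁ - u₃) - v₁   ≡⟨ cong (λ x → s * x - v₁) u₁-u₃≡0 ⟩
      s * 0ℚ - v₁          ≡⟨ solve 2 (λ s v → s :* con 0ℚ :- v := :- v) refl s v₁ ⟩
      - v₁                 ∎))
      where
      s-s′≢0 : s - s′ ≢ 0ℚ
      s-s′≢0 eq = s≢s′ (p-q≡0⇒p≡q s s′ eq)
      u₁-u₃≡0 = p*q≡0⇒q≡0 s-s′≢0 first-factor
      v₁≡v₃ = p-q≡0⇒p≡q v₁ v₃ (p*q≡0⇒q≡0 s-s′≢0 second-factor)

  Secant-third≢first : ∀ {u₁ v₁ u₂ v₂} → v₁ ≢ - v₁ → ¬ Secant u₁ v₁ u₂ v₂ u₁ v₁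
  Secant-third≢first {u₁} {v₁} v₁≢-v₁ S = v₁≢-v₁ (trans reflected
    (solve 3 (λ s u v → s :* (u :- u) :- v := :- v) refl s u₁ v₁))
    where open Secant S

  opposite-or-equal : ∀ u v₁ v₂ → OnCurve E u v₁ → OnCurve E u v₂ → v₁ ≢ - v₂ → v₁ ≡ v₂
  opposite-or-equal u v₁ v₂ on₁ on₂ v₁≢-v₂ =
    p-q≡0⇒p≡q v₁ v₂ (p*q≡0⇒q≡0 (λ eq → v₁≢-v₂ (p-q≡0⇒p≡q v₁ (- v₂) eq))
      (trans (solve 2 (λ x y → (x :- (:- y)) :* (x :- y) := x :* x :- y :* y) refl v₁ v₂)
             (p≡q⇒p-q≡0 (trans on₁ (sym on₂)))))

  -- The graph of adding a fixed affine point. Chords and tangents share the constructor `secant`,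
  -- so cancellation becomes a case analysis on two derivations instead of on the decisions inside
  -- `_⊕_`.
  data Adds (u₁ v₁ : ℚ) .(on₁ : OnCurve E u₁ v₁) : Point E → Point E → Set where
    identity : Adds u₁ v₁ on₁ O (affine u₁ v₁ on₁)
    opposite : ∀ {u₂ v₂} .{on₂} → u₁ ≡ u₂ → v₁ ≡ - v₂ → Adds u₁ v₁ on₁ (affine u₂ v₂ on₂) O
    secant   : ∀ {u₂ v₂ u₃ v₃} .{on₂ on₃} → Secant u₁ v₁ u₂ v₂ u₃ v₃ →
               Adds u₁ v₁ on₁ (affine u₂ v₂ on₂) (affine u₃ v₃ on₃)

  _⊕ₑ_ = _⊕_ E


  chord : ∀ {u₁ v₁ u₂ v₂} .(on₁ : OnCurve E u₁ v₁) .(on₂ : OnCurve E u₂ v₂) s → u₁ ≢ u₂ →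
          s * (u₂ - u₁) ≡ v₂ - v₁ →
          .(on₃ : OnCurve E (thirdU E s u₁ u₂) (sumV E s u₁ v₁ (thirdU E s u₁ u₂))) →
          Adds u₁ v₁ on₁ (affine u₂ v₂ on₂) (affine (thirdU E s u₁ u₂) (sumV E s u₁ v₁ (thirdU E s u₁ u₂)) on₃)
  chord {u₁} {v₁} {u₂} {v₂} on₁ on₂ s u₁≢u₂ slope _ =
    -- The curve equations are irrelevant arguments; decidable equality in ℚ recovers usable proofs
    -- of them.
    secant (secant-of-chord s u₁ v₁ u₂ v₂ u₁≢u₂ slope (recompute (v₁ * v₁ ≟ cubic E u₁) on₁) (recompute (v₂ * v₂ ≟ cubic E u₂) on₂))

  tangent : ∀ {u₁ v₁ u₂ v₂} .(on₁ : OnCurve E u₁ v₁) .(on₂ : OnCurve E u₂ v₂) s → u₁ ≡ u₂ → v₁ ≢ - v₂ →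
            s * (2ℚ * v₁) ≡ cubic′ E u₁ →
            .(on₃ : OnCurve E (thirdU E s u₁ u₁) (sumV E s u₁ v₁ (thirdU E s u₁ u₁))) →
            Adds u₁ v₁ on₁ (affine u₂ v₂ on₂) (affine (thirdU E s u₁ u₁) (sumV E s u₁ v₁ (thirdU E s u₁ u₁)) on₃)
  tangent {u₁} {v₁} {_} {v₂} on₁ on₂ s refl v₁≢-v₂ slope _ =
    secant (subst (λ v → Secant u₁ v₁ u₁ v (thirdU E s u₁ u₁) (sumV E s u₁ v₁ (thirdU E s u₁ u₁)))
      (opposite-or-equal u₁ v₁ v₂ (recompute (v₁ * v₁ ≟ cubic E u₁) on₁) (recompute (v₂ * v₂ ≟ cubic E u₁) on₂) v₁≢-v₂)
      (secant-of-tangent s u₁ v₁ slope))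

  2v₁≢0 : ∀ {u₁ v₁ u₂ v₂} .(on₁ : OnCurve E u₁ v₁) .(on₂ : OnCurve E u₂ v₂) →
          u₁ ≡ u₂ → v₁ ≢ - v₂ → 2ℚ * v₁ ≢ 0ℚ
  2v₁≢0 {u₁} {v₁} {_} {v₂} on₁ on₂ refl v₁≢-v₂ = p≢-p⇒2*p≢0 (λ v₁≡-v₁ → v₁≢-v₂ (trans v₁≡-v₁ (cong -_
    (opposite-or-equal u₁ v₁ v₂ (recompute (v₁ * v₁ ≟ cubic E u₁) on₁) (recompute (v₂ * v₂ ≟ cubic E u₁) on₂) v₁≢-v₂))))

  ⊕-adds : ∀ u₁ v₁ .(on₁ : OnCurve E u₁ v₁) Q → Adds u₁ v₁ on₁ Q (affine u₁ v₁ on₁ ⊕ₑ Q)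
  ⊕-adds u₁ v₁ on₁ O = identity
  ⊕-adds u₁ v₁ on₁ (affine u₂ v₂ on₂) with u₁ ≟ u₂
  ... | no u₁≢u₂ = chord on₁ on₂ (chordSlope E u₁ v₁ u₂ v₂ u₁≢u₂) u₁≢u₂
                     (÷-*-cancel (v₂ - v₁) (u₂ - u₁) {{≢-nonZero (p≢q⇒q-p≢0 u₁≢u₂)}}) _
  ... | yes u₁≡u₂ with v₁ ≟ - v₂
  ...   | yes v₁≡-v₂ = opposite u₁≡u₂ v₁≡-v₂
  -- `tangentSlope` takes its nonvanishing proof irrelevantly, so this proof yields the very slope
  -- that occurs in `_⊕_`.
  ...   | no v₁≢-v₂ = tangent on₁ on₂ (tangentSlope E u₁ v₁ (2v₁≢0 on₁ on₂ u₁≡u₂ v₁≢-v₂)) u₁≡u₂ v₁≢-v₂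
                        (÷-*-cancel (cubic′ E u₁) (2ℚ * v₁) {{≢-nonZero (2v₁≢0 on₁ on₂ u₁≡u₂ v₁≢-v₂)}}) _

  double-opposite : ∀ u v .(on : OnCurve E u v) → v ≡ - v → affine u v on ⊕ₑ affine u v on ≡ O
  double-opposite u v on v≡-v with u ≟ u
  ... | no u≢u = contradiction refl u≢u
  ... | yes _ with v ≟ - v
  ...   | yes _ = refl
  ...   | no v≢-v = contradiction v≡-v v≢-v

  -- For affine `P` the hypothesis gives `v₁ ≢ - v₁`. Then the sum `P` arises only from the summand
  -- `O`, by `Secant-third≢first`, the sum `O` only from the opposite point, and any other sum from
  -- one summand by `Secant-unique`.
  ⊕-cancelˡ : ∀ P → P ⊕ₑ P ≢ O → ∀ {X Y} → P ⊕ₑ X ≡ P ⊕ₑ Y → X ≡ Y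
  ⊕-cancelˡ O P⊕P≢O _ = ⊥-elim (P⊕P≢O refl)
  ⊕-cancelˡ (affine u₁ v₁ on₁) P⊕P≢O {X} {Y} eq =
    cancel (⊕-adds u₁ v₁ on₁ X) (subst (Adds u₁ v₁ on₁ Y) (sym eq) (⊕-adds u₁ v₁ on₁ Y))
    where
    v₁≢-v₁ : v₁ ≢ - v₁
    v₁≢-v₁ v₁≡-v₁ = P⊕P≢O (double-opposite u₁ v₁ on₁ v₁≡-v₁)
    affine-cong : ∀ {u v u′ v′} .{on : OnCurve E u v} .{on′ : OnCurve E u′ v′} →
                  u ≡ u′ → v ≡ v′ → affine u v on ≡ affine u′ v′ on′
    affine-cong refl refl = refl
    cancel : ∀ {X Y Z} → Adds u₁ v₁ on₁ X Z → Adds u₁ v₁ on₁ Y Z → X ≡ Y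
    cancel identity identity = refl
    cancel identity (secant S) = ⊥-elim (Secant-third≢first v₁≢-v₁ S)
    cancel (secant S) identity = ⊥-elim (Secant-third≢first v₁≢-v₁ S)
    cancel (opposite {on₂ = on} u v) (opposite {on₂ = on′} u′ v′) =
      affine-cong {on = on} {on′} (trans (sym u) u′) (neg-injective (trans (sym v) v′))
    cancel (secant {on₂ = on} S) (secant {on₂ = on′} S′) =
      let u≡ , v≡ = Secant-unique v₁≢-v₁ S S′ in affine-cong {on = on} {on′} u≡ v≡

  -- Multiples of a point of infinite order.

  InfiniteOrder : Point E → Set
  InfiniteOrder P = ∀ n → _·_ E (+ suc n) P ≢ O

  multiples-injective : ∀ P → InfiniteOrder P → Injective _≡_ _≡_ (λ n → _·_ E (+ n) P)
  multiples-injective P ∞ {zero}  {zero}  _  = refl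
  multiples-injective P ∞ {zero}  {suc n} eq = ⊥-elim (∞ n (sym eq))
  multiples-injective P ∞ {suc m} {zero}  eq = ⊥-elim (∞ m eq)
  multiples-injective P ∞ {suc m} {suc n} eq =
    -- One copy of `P` is cancelled on both sides; `∞ 1` concerns `P ⊕ (P ⊕ O)`, hence the appeal to
    -- `⊕-identityʳ`.
    cong suc (multiples-injective P ∞ (⊕-cancelˡ P (λ 2P≡O → ∞ 1 (trans (cong (P ⊕ₑ_) (⊕-identityʳ P)) 2P≡O)) eq))
    where
    ⊕-identityʳ : ∀ Q → Q ⊕ₑ O ≡ Q
    ⊕-identityʳ O = refl
    ⊕-identityʳ (affine _ _ _) = refl

  -- Positive rank makes the independent family nonempty. If a positive multiple of its first member
  -- vanished, the coefficients `suc n , 0 , … , 0` would form a nontrivial relation.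
  point-of-infinite-order : HasPositiveRank E → ∃ InfiniteOrder
  point-of-infinite-order (suc r , _ , (P , indep) , _) = P zero , λ n nP≡O →
    contradiction (indep (λ { zero → + suc n ; (suc _) → 0ℤ })
                     (trans (cong (_·_ E (+ suc n) (P zero) ⊕ₑ_) (sum-O r)) (trans (cong (_⊕ₑ O) nP≡O) refl)) zero)
                  λ ()
    where
    sum-O : ∀ r → RawMonoidDefinitions.sum (rawMonoid E) {r} (λ _ → O) ≡ O
    sum-O zero = refl
    sum-O (suc r) = sum-O r

  -- The sequence starts with the first multiple, because the zeroth one is `O` and has no
  -- coordinates.
  infinitely-many-points : HasPositiveRank E →
    Σ (ℕ → ℚ × ℚ) λ p → (∀ n → OnCurve E (proj₁ (p n)) (proj₂ (p n))) × Injective _≡_ _≡_ p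
  infinitely-many-points positive-rank = let P , ∞ = point-of-infinite-order positive-rank in
    (λ n → coordinates (∞ n)) , (λ n → coordinates-on (∞ n)) ,
    λ {m n} eq → ℕ.suc-injective (multiples-injective P ∞ (coordinates-injective (∞ m) (∞ n) eq))
    where
    coordinates : ∀ {Q} → Q ≢ O → ℚ × ℚ
    coordinates {O}            Q≢O = ⊥-elim (Q≢O refl)
    coordinates {affine u v _} _   = u , v
    coordinates-on : ∀ {Q} (Q≢O : Q ≢ O) → OnCurve E (proj₁ (coordinates Q≢O)) (proj₂ (coordinates Q≢O))
    coordinates-on {O}             Q≢O = ⊥-elim (Q≢O refl)
    coordinates-on {affine u v on} _   = recompute (v * v ≟ cubic E u) on
    coordinates-injective : ∀ {Q R} (Q≢O : Q ≢ O) (R≢O : R ≢ O) → coordinates Q≢O ≡ coordinates R≢O → Q ≡ R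
    coordinates-injective {O}            {_}            Q≢O _   _    = ⊥-elim (Q≢O refl)
    coordinates-injective {affine _ _ _} {O}            _   R≢O _    = ⊥-elim (R≢O refl)
    coordinates-injective {affine _ _ _} {affine _ _ _} _   _   refl = refl

-- Signs of rational numbers.

0<p⇒p≢0 : ∀ {p} → 0ℚ < p → p ≢ 0ℚ
0<p⇒p≢0 0<p refl = <-irrefl refl 0<p

*-pos : ∀ {p q} → 0ℚ < p → 0ℚ < q → 0ℚ < p * q
*-pos {p} {q} 0<p 0<q = positive⁻¹ (p * q) {{pos*pos⇒pos p {{positive 0<p}} q {{positive 0<q}}}}

*-pos-neg : ∀ {p q} → 0ℚ < p → q < 0ℚ → p * q < 0ℚ
*-pos-neg {p} {q} 0<p q<0 = negative⁻¹ (p * q) {{pos*neg⇒neg p {{positive 0<p}} q {{negative q<0}}}}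

*-neg-neg : ∀ {p q} → p < 0ℚ → q < 0ℚ → 0ℚ < p * q
*-neg-neg {p} {q} p<0 q<0 = positive⁻¹ (p * q) {{neg*neg⇒pos p {{negative p<0}} q {{negative q<0}}}}

*-neg-pos : ∀ {p q} → p < 0ℚ → 0ℚ < q → p * q < 0ℚ
*-neg-pos {p} {q} p<0 0<q = subst (_< 0ℚ) (*-comm q p) (*-pos-neg 0<q p<0)

0<q-p⇒p<q : ∀ {p q} → 0ℚ < q - p → p < q
0<q-p⇒p<q {p} {q} 0<q-p = subst₂ _<_ (+-identityˡ p)
  (solve 2 (λ p q → (q :- p) :+ p := q) refl p q) (+-monoˡ-< p 0<q-p)

p<q⇒0<q-p : ∀ {p q} → p < q → 0ℚ < q - p
p<q⇒0<q-p {p} {q} p<q = subst (_< q - p) (+-inverseʳ p) (+-monoˡ-< (- p) p<q)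

q-p<0⇒q<p : ∀ {p q} → q - p < 0ℚ → q < p
q-p<0⇒q<p {p} {q} q-p<0 = subst₂ _<_
  (solve 2 (λ p q → (q :- p) :+ p := q) refl p q) (+-identityˡ p) (+-monoˡ-< p q-p<0)

0<2*p⇒0<p : ∀ {p} → 0ℚ < 2ℚ * p → 0ℚ < p
0<2*p⇒0<p {p} 0<2p = *-cancelˡ-<-nonNeg 2ℚ {0ℚ} {p} (subst (_< 2ℚ * p) (sym (*-zeroʳ 2ℚ)) 0<2p)

p≡q*r⇒p÷r≡q : ∀ {p q} r .{{_ : NonZero r}} → p ≡ q * r → p ÷ r ≡ q
p≡q*r⇒p÷r≡q {p} {q} r p≡qr = begin
  p * 1/ r        ≡⟨ cong (_* 1/ r) p≡qr ⟩
  q * r * 1/ r    ≡⟨ *-assoc q r (1/ r) ⟩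
  q * (r * 1/ r)  ≡⟨ cong (q *_) (*-inverseʳ r) ⟩
  q * 1ℚ          ≡⟨ *-identityʳ q ⟩
  q               ∎

pos-factors : ∀ {p q} → 0ℚ < p * q → 0ℚ < p + q → 0ℚ < p × 0ℚ < q
pos-factors {p} {q} 0<pq 0<p+q with <-cmp 0ℚ p | <-cmp 0ℚ q
... | tri< 0<p _ _   | tri< 0<q _ _   = 0<p , 0<q
... | tri< 0<p _ _   | tri≈ _ refl _  = ⊥-elim (<-irrefl (sym (*-zeroʳ p)) 0<pq)
... | tri< 0<p _ _   | tri> _ _ q<0   = ⊥-elim (<-asym 0<pq (*-pos-neg 0<p q<0))
... | tri≈ _ refl _  | _              = ⊥-elim (<-irrefl (sym (*-zeroˡ q)) 0<pq)
... | tri> _ _ p<0   | tri< 0<q _ _   = ⊥-elim (<-asym 0<pq (*-neg-pos p<0 0<q))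
... | tri> _ _ p<0   | tri≈ _ refl _  = ⊥-elim (<-irrefl (sym (*-zeroʳ p)) 0<pq)
... | tri> _ _ p<0   | tri> _ _ q<0   = ⊥-elim (<-asym 0<p+q (+-mono-< p<0 q<0))

opposite-factors : ∀ {p q} → p * q < 0ℚ → (p < 0ℚ × 0ℚ < q) ⊎ (0ℚ < p × q < 0ℚ)
opposite-factors {p} {q} pq<0 with <-cmp 0ℚ p | <-cmp 0ℚ q
... | tri< 0<p _ _   | tri< 0<q _ _   = ⊥-elim (<-asym pq<0 (*-pos 0<p 0<q))
... | tri< 0<p _ _   | tri≈ _ refl _  = ⊥-elim (<-irrefl (*-zeroʳ p) pq<0)
... | tri< 0<p _ _   | tri> _ _ q<0   = inj₂ (0<p , q<0)
... | tri≈ _ refl _  | _              = ⊥-elim (<-irrefl (*-zeroˡ q) pq<0)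
... | tri> _ _ p<0   | tri< 0<q _ _   = inj₁ (p<0 , 0<q)
... | tri> _ _ p<0   | tri≈ _ refl _  = ⊥-elim (<-irrefl (*-zeroʳ p) pq<0)
... | tri> _ _ p<0   | tri> _ _ q<0   = ⊥-elim (<-asym pq<0 (*-neg-neg p<0 q<0))

-- Clearing denominators.

-- In lowest terms by construction, so that numerator and denominator are available by computation,
-- whereas `z / 1` goes through a gcd.
fromℤ : ℤ → ℚ
fromℤ z = mkℚ z 0 (coprime-sym (1-coprimeTo ℤ.∣ z ∣))

fromℤ-isInteger : ∀ z → IsInteger (fromℤ z)
fromℤ-isInteger z = z , sym (↥p/↧p≡p (fromℤ z))

IsInteger-* : ∀ {p q} → IsInteger p → IsInteger q → IsInteger (p * q)
IsInteger-* (i , refl) (j , refl) = i ℤ.* j , cong₂ _*_ (↥p/↧p≡p (fromℤ i)) (↥p/↧p≡p (fromℤ j))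

IsInteger-neg : ∀ {p} → IsInteger p → IsInteger (- p)
IsInteger-neg {p} p∈ℤ = subst IsInteger
  (solve 1 (λ p → con (- 1ℚ) :* p := :- p) refl p) (IsInteger-* (-[1+ 0 ] , refl) p∈ℤ)

0<denominator : ∀ p → 0ℚ < fromℤ (↧ p)
0<denominator p@record{} = positive⁻¹ (fromℤ (↧ p))

p*denominator-isInteger : ∀ p → IsInteger (p * fromℤ (↧ p))
-- The product unfolds to `(↥ p · ↧ p) / (↧ p · 1)`, which is compared with `↥ p / 1` as an
-- unnormalised fraction.
p*denominator-isInteger p@record{} = ↥ p , fromℚᵘ-cong {mkℚᵘ (↥ p ℤ.* ↧ p) _} {mkℚᵘ (↥ p) 0} (*≡*
  (trans (ℤ.*-identityʳ _) (cong (λ d → ↥ p ℤ.* + d) (sym (ℕ.*-identityʳ (↧ₙ p))))))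

common-denominator : ∀ p q r → ∃ λ c → 0ℚ < c × IsInteger (c * p) × IsInteger (c * q) × IsInteger (c * r)
common-denominator p q r = d p * d q * d r ,
  *-pos (*-pos (0<denominator p) (0<denominator q)) (0<denominator r) ,
  subst IsInteger (solve 4 (λ p c d e → p :* c :* (d :* e) := c :* d :* e :* p) refl p (d p) (d q) (d r))
    (IsInteger-* (p*denominator-isInteger p) (IsInteger-* (d∈ℤ q) (d∈ℤ r))) ,
  subst IsInteger (solve 4 (λ p c d e → p :* d :* (c :* e) := c :* d :* e :* p) refl q (d p) (d q) (d r))
    (IsInteger-* (p*denominator-isInteger q) (IsInteger-* (d∈ℤ p) (d∈ℤ r))) ,
  subst IsInteger (solve 4 (λ p c d e → p :* e :* (c :* d) := c :* d :* e :* p) refl r (d p) (d q) (d r))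
    (IsInteger-* (p*denominator-isInteger r) (IsInteger-* (d∈ℤ p) (d∈ℤ q)))
  where
  d : ℚ → ℚ
  d p = fromℤ (↧ p)
  d∈ℤ : ∀ p → IsInteger (d p)
  d∈ℤ p = fromℤ-isInteger (↧ p)

-- From signed solutions to triangles.

-- The equation `R/r = N` cleared of its denominator, meaningful also for negative or degenerate
-- `f`, `g`, `h`.
SatisfiesRatio : (N f g h : ℚ) → Set
SatisfiesRatio N f g h = 2ℚ * f * g * h ≡ N * ((f + g + h) * (f - g - h) * (g - h - f))

signedSides : RationalTriangle → List ℚ
signedSides T = sides T ++ map -_ (sides T)

-- The memberships record how the triangle remembers `f`, `g`, `h` after sign changes and exchanges.
-- They leave finitely many candidates for the ratio `f : g : h`.
SignedTriangle : (N f g h : ℚ) → Set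
SignedTriangle N f g h = ∃ λ T → (IsIntegerTriangle T × R/r T ≡ N) ×
  f ∈ signedSides T × g ∈ signedSides T × h ∈ signedSides T

triangle-inequalities⇒0<f : ∀ {f g h} → g < h + f → h < f + g → 0ℚ < f
triangle-inequalities⇒0<f {f} {g} {h} g<h+f h<f+g = 0<2*p⇒0<p {f} (subst (0ℚ <_)
  (solve 3 (λ f g h → (h :+ f :- g) :+ (f :+ g :- h) := con 2ℚ :* f) refl f g h)
  (+-mono-< (p<q⇒0<q-p g<h+f) (p<q⇒0<q-p h<f+g)))

makeTriangle : ∀ f g h → f < g + h → g < h + f → h < f + g → RationalTriangle
makeTriangle f g h f<g+h g<h+f h<f+g = record
  { f = f ; g = g ; h = h
  ; 0<f = triangle-inequalities⇒0<f g<h+f h<f+g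
  ; 0<g = triangle-inequalities⇒0<f h<f+g f<g+h
  ; 0<h = triangle-inequalities⇒0<f f<g+h g<h+f
  ; f<g+h = f<g+h ; g<h+f = g<h+f ; h<f+g = h<f+g }

R/r≡ : ∀ {N} T → let open RationalTriangle T using (f; g; h) in SatisfiesRatio N f g h → R/r T ≡ N
R/r≡ T eq = p≡q*r⇒p÷r≡q ratioDenominator {{pos⇒nonZero ratioDenominator {{ratioDenominator-positive}}}} eq
  where open RationalTriangle T

-- If f, g, h is not itself a triangle, then one of f and g is negative, and
-- reflecting it and exchanging the other one with h preserves the equation
-- for R/r.
signedTriangle : ∀ {N f g h} → SatisfiesRatio N f g h →
                 IsInteger f → IsInteger g → IsInteger h →
                 0ℚ < h → 0ℚ < f + g + h →
                 0ℚ < f + g - h × 0ℚ < (g + h - f) * (h + f - g) ⊎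
                 f + g - h < 0ℚ × (g + h - f) * (h + f - g) < 0ℚ →
                 SignedTriangle N f g h
signedTriangle {N} {f} {g} {h} eq f∈ℤ g∈ℤ h∈ℤ 0<h 0<f+g+h (inj₁ (0<z , 0<xy)) =
  -- The two factors have sum `2h > 0`, so their positive product makes both of them positive.
  let 0<x , 0<y = pos-factors 0<xy (subst (0ℚ <_)
        (solve 3 (λ f g h → h :+ h := (g :+ h :- f) :+ (h :+ f :- g)) refl f g h) (+-mono-< 0<h 0<h))
      T = makeTriangle f g h (0<q-p⇒p<q 0<x) (0<q-p⇒p<q 0<y) (0<q-p⇒p<q 0<z)
  in T , ((f∈ℤ , g∈ℤ , h∈ℤ) , R/r≡ T eq) ,
       here refl ,
       there (here refl) ,
       there (there (here refl))
signedTriangle {N} {f} {g} {h} eq f∈ℤ g∈ℤ h∈ℤ 0<h 0<f+g+h (inj₂ (z<0 , xy<0)) = by-cases (opposite-factors xy<0)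
  where
  by-cases : g + h - f < 0ℚ × 0ℚ < h + f - g ⊎ 0ℚ < g + h - f × h + f - g < 0ℚ → SignedTriangle N f g h
  by-cases (inj₁ (x<0 , _)) =
    let T = makeTriangle h (- g) f
          (q-p<0⇒q<p (subst (_< 0ℚ) (solve 3 (λ f g h → g :+ h :- f := h :- ((:- g) :+ f)) refl f g h) x<0))
          (0<q-p⇒p<q (subst (0ℚ <_) (solve 3 (λ f g h → f :+ g :+ h := f :+ h :- (:- g)) refl f g h) 0<f+g+h))
          (q-p<0⇒q<p (subst (_< 0ℚ) (solve 3 (λ f g h → f :+ g :- h := f :- (h :+ (:- g))) refl f g h) z<0))
    in T , ((h∈ℤ , IsInteger-neg g∈ℤ , f∈ℤ) , R/r≡ T (begin
        2ℚ * h * (- g) * f  ≡⟨ solve 3 (λ f g h → con 2ℚ :* h :* (:- g) :* f := :- (con 2ℚ :* f :* g :* h)) refl f g h ⟩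
        - (2ℚ * f * g * h)  ≡⟨ cong -_ eq ⟩
        - (N * ((f + g + h) * (f - g - h) * (g - h - f)))
          ≡⟨ solve 4 (λ N f g h → :- (N :* ((f :+ g :+ h) :* (f :- g :- h) :* (g :- h :- f)))
               := N :* ((h :+ (:- g) :+ f) :* (h :- (:- g) :- f) :* ((:- g) :- f :- h))) refl N f g h ⟩
        N * ((h + - g + f) * (h - - g - f) * (- g - f - h)) ∎)) ,
       there (there (here refl)) ,
       there (there (there (there (here (solve 1 (λ g → g := :- (:- g)) refl g))))) ,
       here refl
  by-cases (inj₂ (_ , y<0)) =
    let T = makeTriangle (- f) h g
          (0<q-p⇒p<q (subst (0ℚ <_) (solve 3 (λ f g h → f :+ g :+ h := h :+ g :- (:- f)) refl f g h) 0<f+g+h))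
          (q-p<0⇒q<p (subst (_< 0ℚ) (solve 3 (λ f g h → h :+ f :- g := h :- (g :+ (:- f))) refl f g h) y<0))
          (q-p<0⇒q<p (subst (_< 0ℚ) (solve 3 (λ f g h → f :+ g :- h := g :- ((:- f) :+ h)) refl f g h) z<0))
    in T , ((IsInteger-neg f∈ℤ , h∈ℤ , g∈ℤ) , R/r≡ T (begin
        2ℚ * (- f) * h * g  ≡⟨ solve 3 (λ f g h → con 2ℚ :* (:- f) :* h :* g := :- (con 2ℚ :* f :* g :* h)) refl f g h ⟩
        - (2ℚ * f * g * h)  ≡⟨ cong -_ eq ⟩
        - (N * ((f + g + h) * (f - g - h) * (g - h - f)))
          ≡⟨ solve 4 (λ N f g h → :- (N :* ((f :+ g :+ h) :* (f :- g :- h) :* (g :- h :- f)))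
               := N :* (((:- f) :+ h :+ g) :* ((:- f) :- h :- g) :* (h :- g :- (:- f)))) refl N f g h ⟩
        N * ((- f + h + g) * (- f - h - g) * (h - g - - f)) ∎)) ,
       there (there (there (here (solve 1 (λ f → f := :- (:- f)) refl f)))) ,
       there (there (here refl)) ,
       there (here refl)

-- The sign hypotheses of `signedTriangle`; `f` or `g` may still be negative here.
NonDegenerate : (f g h : ℚ) → Set
NonDegenerate f g h = 0ℚ < h × 0ℚ < f + g + h ×
  (0ℚ < f + g - h × 0ℚ < (g + h - f) * (h + f - g) ⊎
   f + g - h < 0ℚ × (g + h - f) * (h + f - g) < 0ℚ)

-- The ratio equation is homogeneous of degree 3 and the quantities in the sign conditions are
-- homogeneous too, so a positive common denominator can be multiplied in.
scaled-signedTriangle : ∀ {N f g h} → SatisfiesRatio N f g h → NonDegenerate f g h →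
                        ∃ λ c → 0ℚ < c × SignedTriangle N (c * f) (c * g) (c * h)
scaled-signedTriangle {N} {f} {g} {h} eq (0<h , 0<f+g+h , signs) = scale (common-denominator f g h)
  where
  scale : (∃ λ c → 0ℚ < c × IsInteger (c * f) × IsInteger (c * g) × IsInteger (c * h)) →
          ∃ λ c → 0ℚ < c × SignedTriangle N (c * f) (c * g) (c * h)
  scale (c , 0<c , cf∈ℤ , cg∈ℤ , ch∈ℤ) = c , 0<c ,
    signedTriangle scaled-eq cf∈ℤ cg∈ℤ ch∈ℤ (*-pos 0<c 0<h)
      (subst (0ℚ <_) (solve 4 (λ c f g h → c :* (f :+ g :+ h) := c :* f :+ c :* g :+ c :* h) refl c f g h) (*-pos 0<c 0<f+g+h))
      (scaled-signs signs)
    where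
    scaled-eq : SatisfiesRatio N (c * f) (c * g) (c * h)
    scaled-eq = begin
      2ℚ * (c * f) * (c * g) * (c * h)
        ≡⟨ solve 4 (λ c f g h → con 2ℚ :* (c :* f) :* (c :* g) :* (c :* h) := c :* c :* c :* (con 2ℚ :* f :* g :* h)) refl c f g h ⟩
      c * c * c * (2ℚ * f * g * h)
        ≡⟨ cong (c * c * c *_) eq ⟩
      c * c * c * (N * ((f + g + h) * (f - g - h) * (g - h - f)))
        ≡⟨ solve 5 (λ N c f g h → c :* c :* c :* (N :* ((f :+ g :+ h) :* (f :- g :- h) :* (g :- h :- f))) :=
             N :* ((c :* f :+ c :* g :+ c :* h) :* (c :* f :- c :* g :- c :* h) :* (c :* g :- c :* h :- c :* f))) refl N c f g h ⟩
      N * ((c * f + c * g + c * h) * (c * f - c * g - c * h) * (c * g - c * h - c * f)) ∎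
    z-scales : c * (f + g - h) ≡ c * f + c * g - c * h
    z-scales = solve 4 (λ c f g h → c :* (f :+ g :- h) := c :* f :+ c :* g :- c :* h) refl c f g h
    xy-scales : c * c * ((g + h - f) * (h + f - g)) ≡ (c * g + c * h - c * f) * (c * h + c * f - c * g)
    xy-scales = solve 4 (λ c f g h → c :* c :* ((g :+ h :- f) :* (h :+ f :- g)) :=
      (c :* g :+ c :* h :- c :* f) :* (c :* h :+ c :* f :- c :* g)) refl c f g h
    scaled-signs : 0ℚ < f + g - h × 0ℚ < (g + h - f) * (h + f - g) ⊎
                   f + g - h < 0ℚ × (g + h - f) * (h + f - g) < 0ℚ →
                   0ℚ < c * f + c * g - c * h × 0ℚ < (c * g + c * h - c * f) * (c * h + c * f - c * g) ⊎
                   c * f + c * g - c * h < 0ℚ × (c * g + c * h - c * f) * (c * h + c * f - c * g) < 0ℚ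
    scaled-signs (inj₁ (0<z , 0<xy)) = inj₁
      (subst (0ℚ <_) z-scales (*-pos 0<c 0<z) , subst (0ℚ <_) xy-scales (*-pos (*-pos 0<c 0<c) 0<xy))
    scaled-signs (inj₂ (z<0 , xy<0)) = inj₂
      (subst (_< 0ℚ) z-scales (*-pos-neg 0<c z<0) , subst (_< 0ℚ) xy-scales (*-pos-neg (*-pos 0<c 0<c) xy<0))

-- Both quantities take the sign of `m`. For `m = 0`, `f + g - h` vanishes together with `g + h - f`
-- or `h + f - g`, which leaves the ratios `1 : 0 : 1` and `0 : 1 : 1`.
nonDegenerate-or : ∀ {f g h} m α β → 0ℚ < h → 0ℚ < f + g + h → 0ℚ < α → 0ℚ < β →
                   f + g - h ≡ α * m → (g + h - f) * (h + f - g) ≡ β * m →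
                   NonDegenerate f g h ⊎ (f ≡ 0ℚ × g ≡ h) ⊎ (f ≡ h × g ≡ 0ℚ)
nonDegenerate-or {f} {g} {h} m α β 0<h 0<f+g+h 0<α 0<β z≡αm xy≡βm = by-sign (<-cmp 0ℚ m)
  where
  degenerate : f + g - h ≡ 0ℚ → (g + h - f) * (h + f - g) ≡ 0ℚ → Dec (g + h - f ≡ 0ℚ) →
               (f ≡ 0ℚ × g ≡ h) ⊎ (f ≡ h × g ≡ 0ℚ)
  degenerate z≡0 _ (yes x≡0) = inj₂
    ( sym (p-q≡0⇒p≡q h f (*-cancelˡ-≢0 {2ℚ} (λ ()) (trans
        (solve 3 (λ f g h → con 2ℚ :* (h :- f) := (g :+ h :- f) :- (f :+ g :- h)) refl f g h)
        (cong₂ _-_ x≡0 z≡0))))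
    , *-cancelˡ-≢0 {2ℚ} (λ ()) (trans
        (solve 3 (λ f g h → con 2ℚ :* g := (g :+ h :- f) :+ (f :+ g :- h)) refl f g h)
        (cong₂ _+_ x≡0 z≡0)) )
  degenerate z≡0 xy≡0 (no x≢0) = let y≡0 = p*q≡0⇒q≡0 x≢0 xy≡0 in inj₁
    ( *-cancelˡ-≢0 {2ℚ} (λ ()) (trans
        (solve 3 (λ f g h → con 2ℚ :* f := (h :+ f :- g) :+ (f :+ g :- h)) refl f g h)
        (cong₂ _+_ y≡0 z≡0))
    , sym (p-q≡0⇒p≡q h g (*-cancelˡ-≢0 {2ℚ} (λ ()) (trans
        (solve 3 (λ f g h → con 2ℚ :* (h :- g) := (h :+ f :- g) :- (f :+ g :- h)) refl f g h)
        (cong₂ _-_ y≡0 z≡0)))) )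
  by-sign : Tri (0ℚ < m) (0ℚ ≡ m) (m < 0ℚ) → NonDegenerate f g h ⊎ (f ≡ 0ℚ × g ≡ h) ⊎ (f ≡ h × g ≡ 0ℚ)
  by-sign (tri< 0<m _ _) = inj₁ (0<h , 0<f+g+h , inj₁
    (subst (0ℚ <_) (sym z≡αm) (*-pos 0<α 0<m) , subst (0ℚ <_) (sym xy≡βm) (*-pos 0<β 0<m)))
  by-sign (tri≈ _ 0≡m _) = inj₂ (degenerate
    (trans z≡αm (trans (cong (α *_) (sym 0≡m)) (*-zeroʳ α)))
    (trans xy≡βm (trans (cong (β *_) (sym 0≡m)) (*-zeroʳ β)))
    (g + h - f ≟ 0ℚ))
  by-sign (tri> _ _ m<0) = inj₁ (0<h , 0<f+g+h , inj₂
    (subst (_< 0ℚ) (sym z≡αm) (*-pos-neg 0<α m<0) , subst (_< 0ℚ) (sym xy≡βm) (*-pos-neg 0<β m<0)))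

-- The maps from the elliptic curve to the solutions.

-- For either value of the Boolean this is a birational map from 𝓔 N to the
-- cubic of solutions f : g : h; the two differ by negation and translation by
-- the point (0 , 0). The first one is used for u > 0, the second for u < 0.
module _ (N : ℚ) where

  sideF sideG : Bool → ℚ → ℚ → ℚ
  sideF true  u v = 4ℚ * N - 1ℚ - (2ℚ * N - 1ℚ) * u - v
  sideF false u v = u * u + (2ℚ * N - 1ℚ) * u + v
  sideG true  u v = 4ℚ * N - 1ℚ - (2ℚ * N - 1ℚ) * u + v
  sideG false u v = u * u + (2ℚ * N - 1ℚ) * u - v

  sideH : Bool → ℚ → ℚ
  sideH true  u = 4ℚ * N * u
  sideH false u = - (4ℚ * N * u)

  HasSign : Bool → ℚ → Set
  HasSign true  u = 0ℚ < u
  HasSign false u = u < 0ℚ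

  -- The defect of the ratio equation is the defect of the curve equation times `8N(4N - 1)` for
  -- `true` and `8Nu²` for `false`.
  sides-satisfyRatio : ∀ b {u v} → OnCurve (𝓔 N) u v → SatisfiesRatio N (sideF b u v) (sideG b u v) (sideH b u)
  sides-satisfyRatio true {u} {v} on = p-q≡0⇒p≡q _ _ (trans
    (solve 3 (λ N u v →
       let a = con 2ℚ :* (con 2ℚ :* (N :* N) :+ con 2ℚ :* N :- con 1ℚ)
           b = :- (con 4ℚ :* N :- con 1ℚ)
           A = con 4ℚ :* N :- con 1ℚ :- (con 2ℚ :* N :- con 1ℚ) :* u
           f = A :- v
           g = A :+ v
           h = con 4ℚ :* N :* u in
       con 2ℚ :* f :* g :* h :- N :* ((f :+ g :+ h) :* (f :- g :- h) :* (g :- h :- f)) :=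
       con (+ 8 / 1) :* N :* (con 4ℚ :* N :- con 1ℚ) :* (v :* v :- (u :* u :* u :+ a :* (u :* u) :+ b :* u)))
       refl N u v)
    (trans (cong (+ 8 / 1 * N * (4ℚ * N - 1ℚ) *_) (p≡q⇒p-q≡0 on)) (*-zeroʳ (+ 8 / 1 * N * (4ℚ * N - 1ℚ)))))
  sides-satisfyRatio false {u} {v} on = p-q≡0⇒p≡q _ _ (trans
    (solve 3 (λ N u v →
       let a = con 2ℚ :* (con 2ℚ :* (N :* N) :+ con 2ℚ :* N :- con 1ℚ)
           b = :- (con 4ℚ :* N :- con 1ℚ)
           B = u :* u :+ (con 2ℚ :* N :- con 1ℚ) :* u
           f = B :+ v
           g = B :- v
           h = :- (con 4ℚ :* N :* u) in
       con 2ℚ :* f :* g :* h :- N :* ((f :+ g :+ h) :* (f :- g :- h) :* (g :- h :- f)) :=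
       con (+ 8 / 1) :* N :* (u :* u) :* (v :* v :- (u :* u :* u :+ a :* (u :* u) :+ b :* u)))
       refl N u v)
    (trans (cong (+ 8 / 1 * N * (u * u) *_) (p≡q⇒p-q≡0 on)) (*-zeroʳ (+ 8 / 1 * N * (u * u)))))

  -- For either Boolean the product is `h² - (f - g)² = 16N²u² - 4v²`; replacing `v²` by the cubic
  -- leaves a polynomial in `u` that splits into linear factors.
  product-xy : ∀ b {u v} → OnCurve (𝓔 N) u v →
               let f = sideF b u v ; g = sideG b u v ; h = sideH b u in
               (g + h - f) * (h + f - g) ≡ 4ℚ * u * (1ℚ - u) * (u + (4ℚ * N - 1ℚ))
  product-xy true {u} {v} on = p-q≡0⇒p≡q _ _ (trans
    (solve 3 (λ N u v →
       let a = con 2ℚ :* (con 2ℚ :* (N :* N) :+ con 2ℚ :* N :- con 1ℚ)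
           b = :- (con 4ℚ :* N :- con 1ℚ)
           A = con 4ℚ :* N :- con 1ℚ :- (con 2ℚ :* N :- con 1ℚ) :* u
           f = A :- v
           g = A :+ v
           h = con 4ℚ :* N :* u in
       (g :+ h :- f) :* (h :+ f :- g) :- con 4ℚ :* u :* (con 1ℚ :- u) :* (u :+ (con 4ℚ :* N :- con 1ℚ)) :=
       :- con 4ℚ :* (v :* v :- (u :* u :* u :+ a :* (u :* u) :+ b :* u)))
       refl N u v)
    (cong (- 4ℚ *_) (p≡q⇒p-q≡0 on)))
  product-xy false {u} {v} on = p-q≡0⇒p≡q _ _ (trans
    (solve 3 (λ N u v →
       let a = con 2ℚ :* (con 2ℚ :* (N :* N) :+ con 2ℚ :* N :- con 1ℚ)
           b = :- (con 4ℚ :* N :- con 1ℚ)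
           B = u :* u :+ (con 2ℚ :* N :- con 1ℚ) :* u
           f = B :+ v
           g = B :- v
           h = :- (con 4ℚ :* N :* u) in
       (g :+ h :- f) :* (h :+ f :- g) :- con 4ℚ :* u :* (con 1ℚ :- u) :* (u :+ (con 4ℚ :* N :- con 1ℚ)) :=
       :- con 4ℚ :* (v :* v :- (u :* u :* u :+ a :* (u :* u) :+ b :* u)))
       refl N u v)
    (cong (- 4ℚ *_) (p≡q⇒p-q≡0 on)))

  HasSign⇒u≢0 : ∀ b {u} → HasSign b u → u ≢ 0ℚ
  HasSign⇒u≢0 true  0<u refl = <-irrefl refl 0<u
  HasSign⇒u≢0 false u<0 refl = <-irrefl refl u<0

  hasSign? : ∀ b u → Dec (HasSign b u)
  hasSign? true  u = 0ℚ <? u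
  hasSign? false u = u <? 0ℚ

  sign-of : ∀ {u} → u ≢ 0ℚ → ∃ λ b → HasSign b u
  sign-of {u} u≢0 with <-cmp 0ℚ u
  ... | tri< 0<u _ _ = true , 0<u
  ... | tri≈ _ 0≡u _ = ⊥-elim (u≢0 (sym 0≡u))
  ... | tri> _ _ u<0 = false , u<0

  module _ (1/4<N : + 1 / 4 < N) where

    0<4N-1 : 0ℚ < 4ℚ * N - 1ℚ
    0<4N-1 = subst (0ℚ <_) (solve 1 (λ N → con 4ℚ :* (N :- con (+ 1 / 4)) := con 4ℚ :* N :- con 1ℚ) refl N)
      (*-pos {4ℚ} {N - + 1 / 4} (positive⁻¹ 4ℚ) (p<q⇒0<q-p 1/4<N))

    0<4N : 0ℚ < 4ℚ * N
    0<4N = subst (0ℚ <_) (solve 1 (λ N → con 4ℚ :* N :- con 1ℚ :+ con 1ℚ := con 4ℚ :* N) refl N)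
      (+-mono-< 0<4N-1 (positive⁻¹ 1ℚ))

    -- The Boolean is chosen so that all factors but one have a known sign. For `u > 0` the common
    -- factor `m` is `1 - u` and the perimeter is `2(u + 4N - 1)`; for `u < 0` they are
    -- `-(u + 4N - 1)` and `-2u(1 - u)`.
    sides-nonDegenerate-or : ∀ b {u v} → HasSign b u → OnCurve (𝓔 N) u v →
      let f = sideF b u v ; g = sideG b u v ; h = sideH b u in
      NonDegenerate f g h ⊎ (f ≡ 0ℚ × g ≡ h) ⊎ (f ≡ h × g ≡ 0ℚ)
    sides-nonDegenerate-or true {u} {v} 0<u on =
      nonDegenerate-or (1ℚ - u) (2ℚ * (4ℚ * N - 1ℚ)) (4ℚ * u * (u + (4ℚ * N - 1ℚ)))
        (*-pos 0<4N 0<u)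
        (subst (0ℚ <_)
          (solve 3 (λ N u v → con 2ℚ :* (u :+ (con 4ℚ :* N :- con 1ℚ)) :=
            (con 4ℚ :* N :- con 1ℚ :- (con 2ℚ :* N :- con 1ℚ) :* u :- v) :+
            (con 4ℚ :* N :- con 1ℚ :- (con 2ℚ :* N :- con 1ℚ) :* u :+ v) :+ con 4ℚ :* N :* u) refl N u v)
          (*-pos {2ℚ} {u + (4ℚ * N - 1ℚ)} (positive⁻¹ 2ℚ) 0<u+4N-1))
        (*-pos {2ℚ} {4ℚ * N - 1ℚ} (positive⁻¹ 2ℚ) 0<4N-1)
        (*-pos {4ℚ * u} (*-pos {4ℚ} {u} (positive⁻¹ 4ℚ) 0<u) 0<u+4N-1)
        (solve 3 (λ N u v →
            (con 4ℚ :* N :- con 1ℚ :- (con 2ℚ :* N :- con 1ℚ) :* u :- v) :+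
            (con 4ℚ :* N :- con 1ℚ :- (con 2ℚ :* N :- con 1ℚ) :* u :+ v) :- con 4ℚ :* N :* u :=
            con 2ℚ :* (con 4ℚ :* N :- con 1ℚ) :* (con 1ℚ :- u)) refl N u v)
        (trans (product-xy true {u} {v} on)
          (solve 2 (λ N u → con 4ℚ :* u :* (con 1ℚ :- u) :* (u :+ (con 4ℚ :* N :- con 1ℚ)) :=
            con 4ℚ :* u :* (u :+ (con 4ℚ :* N :- con 1ℚ)) :* (con 1ℚ :- u)) refl N u))
      where
      0<u+4N-1 : 0ℚ < u + (4ℚ * N - 1ℚ)
      0<u+4N-1 = +-mono-< 0<u 0<4N-1
    sides-nonDegenerate-or false {u} {v} u<0 on =
      nonDegenerate-or (- (u + (4ℚ * N - 1ℚ))) (2ℚ * (- u)) (4ℚ * (- u) * (1ℚ - u))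
        (subst (0ℚ <_) (solve 2 (λ N u → con 4ℚ :* N :* (:- u) := :- (con 4ℚ :* N :* u)) refl N u)
          (*-pos 0<4N 0<-u))
        (subst (0ℚ <_)
          (solve 3 (λ N u v → con 2ℚ :* (:- u) :* (con 1ℚ :- u) :=
            (u :* u :+ (con 2ℚ :* N :- con 1ℚ) :* u :+ v) :+
            (u :* u :+ (con 2ℚ :* N :- con 1ℚ) :* u :- v) :+ (:- (con 4ℚ :* N :* u))) refl N u v)
          (*-pos 0<2*-u 0<1-u))
        0<2*-u
        (*-pos {4ℚ * (- u)} (*-pos {4ℚ} (positive⁻¹ 4ℚ) 0<-u) 0<1-u)
        (solve 3 (λ N u v →
            (u :* u :+ (con 2ℚ :* N :- con 1ℚ) :* u :+ v) :+
            (u :* u :+ (con 2ℚ :* N :- con 1ℚ) :* u :- v) :- (:- (con 4ℚ :* N :* u)) :=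
            con 2ℚ :* (:- u) :* (:- (u :+ (con 4ℚ :* N :- con 1ℚ)))) refl N u v)
        (trans (product-xy false {u} {v} on)
          (solve 2 (λ N u → con 4ℚ :* u :* (con 1ℚ :- u) :* (u :+ (con 4ℚ :* N :- con 1ℚ)) :=
            con 4ℚ :* (:- u) :* (con 1ℚ :- u) :* (:- (u :+ (con 4ℚ :* N :- con 1ℚ)))) refl N u))
      where
      0<-u : 0ℚ < - u
      0<-u = neg-antimono-< u<0
      0<2*-u : 0ℚ < 2ℚ * (- u)
      0<2*-u = *-pos {2ℚ} (positive⁻¹ 2ℚ) 0<-u
      0<1-u : 0ℚ < 1ℚ - u
      0<1-u = +-mono-< (positive⁻¹ 1ℚ) 0<-u

    sideH≢0 : ∀ b {u} → u ≢ 0ℚ → sideH b u ≢ 0ℚ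
    sideH≢0 true  u≢0 h≡0 = u≢0 (p*q≡0⇒q≡0 (0<p⇒p≢0 0<4N) h≡0)
    sideH≢0 false u≢0 h≡0 = u≢0 (p*q≡0⇒q≡0 (0<p⇒p≢0 0<4N) (neg-injective h≡0))

    -- Adding the two equations eliminates `v`, since `f + g` is free of it. The quotient
    -- `(f + g) / h` is affine and nonconstant in `1/u` for `true` and in `u` for `false`, hence
    -- injective.
    cross-ratio⇒u≡ : ∀ b {u v u′ v′} → u ≢ 0ℚ → u′ ≢ 0ℚ →
                     sideF b u v * sideH b u′ ≡ sideF b u′ v′ * sideH b u →
                     sideG b u v * sideH b u′ ≡ sideG b u′ v′ * sideH b u → u ≡ u′
    cross-ratio⇒u≡ true {u} {v} {u′} {v′} _ _ eqF eqG = sym (p-q≡0⇒p≡q u′ u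
      (p*q≡0⇒q≡0 (0<p⇒p≢0 (*-pos 0<4N (*-pos {2ℚ} (positive⁻¹ 2ℚ) 0<4N-1))) (trans
        (solve 5 (λ N u v u′ v′ →
          let A = λ u → con 4ℚ :* N :- con 1ℚ :- (con 2ℚ :* N :- con 1ℚ) :* u
              H = λ u → con 4ℚ :* N :* u in
          con 4ℚ :* N :* (con 2ℚ :* (con 4ℚ :* N :- con 1ℚ)) :* (u′ :- u) :=
          ((A u :- v) :* H u′ :- (A u′ :- v′) :* H u) :+ ((A u :+ v) :* H u′ :- (A u′ :+ v′) :* H u))
          refl N u v u′ v′)
        (cong₂ _+_ (p≡q⇒p-q≡0 eqF) (p≡q⇒p-q≡0 eqG)))))
    cross-ratio⇒u≡ false {u} {v} {u′} {v′} u≢0 u′≢0 eqF eqG = sym (p-q≡0⇒p≡q u′ u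
      (p*q≡0⇒q≡0 u′≢0 (p*q≡0⇒q≡0 u≢0 (p*q≡0⇒q≡0 (0<p⇒p≢0 0<4N) (p*q≡0⇒q≡0 {2ℚ} (λ ()) (trans
        (solve 5 (λ N u v u′ v′ →
          let B = λ u → u :* u :+ (con 2ℚ :* N :- con 1ℚ) :* u
              H = λ u → :- (con 4ℚ :* N :* u) in
          con 2ℚ :* (con 4ℚ :* N :* (u :* (u′ :* (u′ :- u)))) :=
          ((B u :+ v) :* H u′ :- (B u′ :+ v′) :* H u) :+ ((B u :- v) :* H u′ :- (B u′ :- v′) :* H u))
          refl N u v u′ v′)
        (cong₂ _+_ (p≡q⇒p-q≡0 eqF) (p≡q⇒p-q≡0 eqG))))))))

    sideF-injective : ∀ b {u v v′} → sideF b u v ≡ sideF b u v′ → v ≡ v′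
    sideF-injective true  {u} {v} {v′} eq = sym (p-q≡0⇒p≡q v′ v (trans
      (solve 3 (λ A v v′ → v′ :- v := (A :- v) :- (A :- v′)) refl (4ℚ * N - 1ℚ - (2ℚ * N - 1ℚ) * u) v v′)
      (p≡q⇒p-q≡0 eq)))
    sideF-injective false {u} {v} {v′} eq = p-q≡0⇒p≡q v v′ (trans
      (solve 3 (λ B v v′ → v :- v′ := (B :+ v) :- (B :+ v′)) refl (u * u + (2ℚ * N - 1ℚ) * u) v v′)
      (p≡q⇒p-q≡0 eq))

    cross-ratio-injective : ∀ b {u v u′ v′} → u ≢ 0ℚ → u′ ≢ 0ℚ →
                            sideF b u v * sideH b u′ ≡ sideF b u′ v′ * sideH b u →
                            sideG b u v * sideH b u′ ≡ sideG b u′ v′ * sideH b u →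
                            (u , v) ≡ (u′ , v′)
    cross-ratio-injective b {u} {v} {u′} {v′} u≢0 u′≢0 eqF eqG with cross-ratio⇒u≡ b u≢0 u′≢0 eqF eqG
    ... | refl = cong (u ,_) (sideF-injective b (*-cancelˡ-≢0 (sideH≢0 b u≢0)
      (trans (*-comm (sideH b u) (sideF b u v)) (trans eqF (*-comm (sideF b u v′) (sideH b u))))))

-- Avoiding finitely many keys, and greedy choice.

module _ {K A : Set} {M : K → A → Set} (M? : ∀ κ x → Dec (M κ x)) (p : ℕ → A)
         (unique : ∀ κ {m n} → M κ (p m) → M κ (p n) → m ≡ n) where

  -- The lower bound `k` carries the induction: if the index found for the tail matches `κ`, every
  -- later index misses `κ` by `unique`, and the tail is searched again beyond it.
  fresh : ∀ κs k → ∃ λ n → k ℕ.≤ n × (∀ {κ} → κ ∈ κs → ¬ M κ (p n))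
  fresh []       k = k , ℕ.≤-refl , λ ()
  fresh (κ ∷ κs) k with fresh κs k
  ... | m , k≤m , avoids with M? κ (p m)
  ...   | no ¬Mκm = m , k≤m , λ { (here refl) → ¬Mκm ; (there κ∈κs) → avoids κ∈κs }
  ...   | yes Mκm = let n , m<n , avoids′ = fresh κs (suc m) in
    n , ℕ.≤-trans k≤m (ℕ.<⇒≤ m<n) , λ
      { (here refl) Mκn → ℕ.<⇒≢ m<n (unique κ Mκm Mκn)
      ; (there κ∈κs) → avoids′ κ∈κs }

module _ {A : Set} {_≈_ : A → A → Set}
         (next : (xs : List A) → ∃ λ x → ∀ {y} → y ∈ xs → ¬ (x ≈ y ⊎ y ≈ x)) where

  chosen : ℕ → List A
  chosen zero    = []
  chosen (suc n) = proj₁ (next (chosen n)) ∷ chosen n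

  greedy : ℕ → A
  greedy n = proj₁ (next (chosen n))

  greedy-chosen : ∀ {m n} → m ℕ.< n → greedy m ∈ chosen n
  greedy-chosen {m} {suc n} (ℕ.s≤s m≤n) with ℕ.m≤n⇒m<n∨m≡n m≤n
  ... | inj₁ m<n  = there (greedy-chosen m<n)
  ... | inj₂ refl = here refl

  -- Of two distinct indices, the later term was chosen against a list containing the earlier one;
  -- `next` excludes both directions of `_≈_`, which settles either order.
  greedy-injective : Injective _≡_ _≈_ greedy
  greedy-injective {m} {n} m≈n with ℕ.<-cmp m n
  ... | tri< m<n _ _ = ⊥-elim (proj₂ (next (chosen n)) (greedy-chosen m<n) (inj₂ m≈n))
  ... | tri≈ _ m≡n _ = m≡n
  ... | tri> _ _ n<m = ⊥-elim (proj₂ (next (chosen m)) (greedy-chosen n<m) (inj₁ m≈n))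

-- Similarity and the finitely many ratios it allows.

-- A consequence of similarity in either direction that forgets the labelling and suffices to carry
-- ratios of signed sides from `T` to `T′`.
ScalesInto : RationalTriangle → RationalTriangle → Set
ScalesInto T T′ = ∃ λ k → k ≢ 0ℚ × (∀ {s} → s ∈ sides T → k * s ∈ sides T′)

∼⇒ScalesInto : ∀ {T T′} → T ∼ T′ → ScalesInto T T′
∼⇒ScalesInto (k , 0<k , perm) = k , 0<p⇒p≢0 0<k , λ s∈T → ∈-resp-↭ perm (∈-map⁺ (k *_) s∈T)

∼⇒ScalesInto˘ : ∀ {T T′} → T ∼ T′ → ScalesInto T′ T
∼⇒ScalesInto˘ {T} {T′} (k , 0<k , perm) = 1/ k , 1/k≢0 , λ s∈T′ → unscale (∈-map⁻ (k *_) (∈-resp-↭ (↭-sym perm) s∈T′))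
  where
  instance
    _ = ≢-nonZero (0<p⇒p≢0 0<k)
  1/k≢0 : 1/ k ≢ 0ℚ
  1/k≢0 1/k≡0 = 1≢0 (trans (sym (*-inverseʳ k)) (trans (cong (k *_) 1/k≡0) (*-zeroʳ k)))
  unscale : ∀ {s} → (∃ λ t → t ∈ sides T × s ≡ k * t) → 1/ k * s ∈ sides T
  unscale (t , t∈T , refl) = subst (_∈ sides T) (begin
    t               ≡⟨ *-identityˡ t ⟨
    1ℚ * t          ≡⟨ cong (_* t) (*-inverseˡ k) ⟨
    1/ k * k * t    ≡⟨ *-assoc (1/ k) k t ⟩
    1/ k * (k * t)  ∎) t∈T

scale-signedSides : ∀ {T T′} ((k , _) : ScalesInto T T′) {s} → s ∈ signedSides T → k * s ∈ signedSides T′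
scale-signedSides {T} {T′} (k , _ , into) {s} s∈ = split (∈-++⁻ (sides T) s∈)
  where
  negate : (∃ λ t → t ∈ sides T × s ≡ - t) → k * s ∈ signedSides T′
  negate (t , t∈T , refl) = ∈-++⁺ʳ (sides T′) (subst (_∈ map -_ (sides T′))
    (neg-distribʳ-* k t) (∈-map⁺ -_ (into t∈T)))
  split : s ∈ sides T ⊎ s ∈ map -_ (sides T) → k * s ∈ signedSides T′
  split (inj₁ s∈T)  = ∈-++⁺ˡ (into s∈T)
  split (inj₂ s∈-T) = negate (∈-map⁻ -_ s∈-T)

-- The points matching ratio (b , c , d , e) are those sent to c : d : e by the
-- map with Boolean b; every key is matched by at most one point of the curve.
data Key : Set where
  at-zero : Key
  ratio   : Bool × ℚ × ℚ × ℚ → Key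

-- All triples are listed, whichever side each entry is, because `SignedTriangle` only records
-- memberships.
similarityKeys : RationalTriangle → List Key
similarityKeys T = map ratio (cartesianProduct (true ∷ false ∷ []) (cartesianProduct S (cartesianProduct S S)))
  where S = signedSides T

ratio∈similarityKeys : ∀ T b {c d e} → c ∈ signedSides T → d ∈ signedSides T → e ∈ signedSides T →
                       ratio (b , c , d , e) ∈ similarityKeys T
ratio∈similarityKeys T b c∈ d∈ e∈ =
  ∈-map⁺ ratio (∈-cartesianProduct⁺ (bool∈ b) (∈-cartesianProduct⁺ c∈ (∈-cartesianProduct⁺ d∈ e∈)))
  where
  bool∈ : ∀ b → b ∈ true ∷ false ∷ []
  bool∈ true  = here refl
  bool∈ false = there (here refl)

-- The exceptional ratios of `nonDegenerate-or`, for both maps.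
degenerateKeys : List Key
degenerateKeys = ratio (true , 0ℚ , 1ℚ , 1ℚ) ∷ ratio (false , 0ℚ , 1ℚ , 1ℚ) ∷ ratio (true , 1ℚ , 0ℚ , 1ℚ) ∷ ratio (false , 1ℚ , 0ℚ , 1ℚ) ∷ []

degenerate-0∷1∈ : ∀ b → ratio (b , 0ℚ , 1ℚ , 1ℚ) ∈ degenerateKeys
degenerate-0∷1∈ true  = here refl
degenerate-0∷1∈ false = there (here refl)

degenerate-1∷0∈ : ∀ b → ratio (b , 1ℚ , 0ℚ , 1ℚ) ∈ degenerateKeys
degenerate-1∷0∈ true  = there (there (here refl))
degenerate-1∷0∈ false = there (there (there (here refl)))

-- Choosing points whose triangles are new.

module _ (N : ℚ) where

  -- Proportionality is expressed by cross-multiplication; `e ≢ 0ℚ` keeps the triple `0 , 0 , 0`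
  -- from matching every point of the given sign.
  Matches : Key → ℚ × ℚ → Set
  Matches at-zero         (u , v) = u ≡ 0ℚ
  Matches (ratio (b , c , d , e)) (u , v) = HasSign N b u × e ≢ 0ℚ ×
    sideF N b u v * e ≡ c * sideH N b u × sideG N b u v * e ≡ d * sideH N b u

  matches? : ∀ κ p → Dec (Matches κ p)
  matches? at-zero         (u , v) = u ≟ 0ℚ
  matches? (ratio (b , c , d , e)) (u , v) = hasSign? N b u ×-dec ¬? (e ≟ 0ℚ) ×-dec
    (sideF N b u v * e ≟ c * sideH N b u) ×-dec (sideG N b u v * e ≟ d * sideH N b u)

  on-curve-at-zero : ∀ {v} → OnCurve (𝓔 N) 0ℚ v → v ≡ 0ℚ
  on-curve-at-zero {v} on with v ≟ 0ℚ
  ... | yes v≡0 = v≡0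
  ... | no  v≢0 = p*q≡0⇒q≡0 v≢0 (trans on (solve 2 (λ a b →
          con 0ℚ :* con 0ℚ :* con 0ℚ :+ a :* (con 0ℚ :* con 0ℚ) :+ b :* con 0ℚ := con 0ℚ) refl (Curve.a (𝓔 N)) (Curve.b (𝓔 N))))

  module _ (1/4<N : + 1 / 4 < N) where

    -- Over `u = 0` the curve has only the point `(0 , 0)`. For a ratio, eliminating `c`, `d`, `e`
    -- gives the cross-multiplied equations of `cross-ratio-injective`.
    matches-unique : ∀ κ {u v u′ v′} → OnCurve (𝓔 N) u v → OnCurve (𝓔 N) u′ v′ →
                     Matches κ (u , v) → Matches κ (u′ , v′) → (u , v) ≡ (u′ , v′)
    matches-unique at-zero on on′ refl refl = cong (0ℚ ,_) (trans (on-curve-at-zero on) (sym (on-curve-at-zero on′)))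
    matches-unique (ratio (b , c , d , e)) {u} {v} {u′} {v′} _ _ (sgn , e≢0 , f , g) (sgn′ , _ , f′ , g′) =
      cross-ratio-injective N 1/4<N b (HasSign⇒u≢0 N b sgn) (HasSign⇒u≢0 N b sgn′)
        (cross (sideF N b u v) c (sideF N b u′ v′) f f′) (cross (sideG N b u v) d (sideG N b u′ v′) g g′)
      where
      cross : ∀ s c s′ → s * e ≡ c * sideH N b u → s′ * e ≡ c * sideH N b u′ →
              s * sideH N b u′ ≡ s′ * sideH N b u
      cross s c s′ eq eq′ = *-cancelˡ-≢0 e≢0 (begin
        e * (s * h′)  ≡⟨ solve 3 (λ e s h → e :* (s :* h) := s :* e :* h) refl e s h′ ⟩
        s * e * h′    ≡⟨ cong (_* h′) eq ⟩
        c * h * h′    ≡⟨ solve 3 (λ c h h′ → c :* h :* h′ := c :* h′ :* h) refl c h h′ ⟩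
        c * h′ * h    ≡⟨ cong (_* h) eq′ ⟨
        s′ * e * h    ≡⟨ solve 3 (λ e s h → s :* e :* h := e :* (s :* h)) refl e s′ h ⟩
        e * (s′ * h)  ∎)
        where
        h = sideH N b u
        h′ = sideH N b u′

    IntegerTriangle : Set
    IntegerTriangle = ∃ λ T → IsIntegerTriangle T × R/r T ≡ N

    Similar : IntegerTriangle → IntegerTriangle → Set
    Similar x y = proj₁ x ∼ proj₁ y

    keysOf : List RationalTriangle → List Key
    keysOf Ts = at-zero ∷ degenerateKeys ++ concatMap similarityKeys Ts

    scaled-matches : ∀ b {u v c k} → HasSign N b u → 0ℚ < c → k ≢ 0ℚ →
                     Matches (ratio (b , k * (c * sideF N b u v) , k * (c * sideG N b u v) , k * (c * sideH N b u))) (u , v)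
    scaled-matches b {u} {v} {c} {k} sgn 0<c k≢0 =
      sgn , kch≢0 , swap (sideF N b u v) , swap (sideG N b u v)
      where
      h = sideH N b u
      kch≢0 : k * (c * h) ≢ 0ℚ
      kch≢0 eq = sideH≢0 N 1/4<N b (HasSign⇒u≢0 N b sgn) (p*q≡0⇒q≡0 (0<p⇒p≢0 0<c) (p*q≡0⇒q≡0 k≢0 eq))
      swap : ∀ s → s * (k * (c * h)) ≡ k * (c * s) * h
      swap s = solve 4 (λ s k c h → s :* (k :* (c :* h)) := k :* (c :* s) :* h) refl s k c h

    sides-nonDegenerate : ∀ Ts b {u v} → HasSign N b u → OnCurve (𝓔 N) u v →
                          (∀ {κ} → κ ∈ keysOf Ts → ¬ Matches κ (u , v)) →
                          NonDegenerate (sideF N b u v) (sideG N b u v) (sideH N b u)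
    sides-nonDegenerate Ts b {u} {v} sgn on avoids = exclude (sides-nonDegenerate-or N 1/4<N b sgn on)
      where
      f = sideF N b u v
      g = sideG N b u v
      h = sideH N b u
      exclude : NonDegenerate f g h ⊎ (f ≡ 0ℚ × g ≡ h) ⊎ (f ≡ h × g ≡ 0ℚ) → NonDegenerate f g h
      exclude (inj₁ nondegenerate) = nondegenerate
      exclude (inj₂ (inj₁ (f≡0 , g≡h))) = ⊥-elim (avoids (there (∈-++⁺ˡ (degenerate-0∷1∈ b)))
        (sgn , 1≢0 , trans (cong (_* 1ℚ) f≡0) (sym (*-zeroˡ h)) , trans (cong (_* 1ℚ) g≡h) (*-comm h 1ℚ)))
      exclude (inj₂ (inj₂ (f≡h , g≡0))) = ⊥-elim (avoids (there (∈-++⁺ˡ (degenerate-1∷0∈ b)))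
        (sgn , 1≢0 , trans (cong (_* 1ℚ) f≡h) (*-comm h 1ℚ) , trans (cong (_* 1ℚ) g≡0) (sym (*-zeroˡ h))))

    -- If `k` scaled `T` into `T′`, then `kcf`, `kcg`, `kch` would be signed sides of `T′`. Their
    -- ratio is a key of `T′`, and the point `(u , v)` matches it.
    avoids⇒not-scaled : ∀ Ts b {u v c T T′} → HasSign N b u → 0ℚ < c →
                        c * sideF N b u v ∈ signedSides T →
                        c * sideG N b u v ∈ signedSides T →
                        c * sideH N b u ∈ signedSides T →
                        (∀ {κ} → κ ∈ keysOf Ts → ¬ Matches κ (u , v)) →
                        T′ ∈ Ts → ¬ ScalesInto T T′
    avoids⇒not-scaled Ts b {u} {v} {c} {T} {T′} sgn 0<c f∈ g∈ h∈ avoids T′∈Ts scales@(k , k≢0 , _) =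
      avoids {κ} (there (∈-++⁺ʳ degenerateKeys (∈-concatMap⁺ similarityKeys (lose T′∈Ts κ∈))))
        (scaled-matches b sgn 0<c k≢0)
      where
      κ : Key
      κ = ratio (b , k * (c * sideF N b u v) , k * (c * sideG N b u v) , k * (c * sideH N b u))
      κ∈ : κ ∈ similarityKeys T′
      κ∈ = ratio∈similarityKeys T′ b
        (scale-signedSides {T} {T′} scales f∈) (scale-signedSides {T} {T′} scales g∈) (scale-signedSides {T} {T′} scales h∈)

    new-triangle : ∀ Ts {u v} → OnCurve (𝓔 N) u v →
                   (∀ {κ} → κ ∈ keysOf Ts → ¬ Matches κ (u , v)) →
                   Σ IntegerTriangle λ x → ∀ {T′} → T′ ∈ Ts → ¬ ScalesInto (proj₁ x) T′
    -- `here refl` locates `at-zero`, and avoiding that key means `u ≢ 0ℚ`.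
    new-triangle Ts {u} {v} on avoids = from-sign (sign-of N (avoids (here refl)))
      where
      from-triangle : ∀ b → HasSign N b u →
                      (∃ λ c → 0ℚ < c × SignedTriangle N (c * sideF N b u v) (c * sideG N b u v) (c * sideH N b u)) →
                      Σ IntegerTriangle λ x → ∀ {T′} → T′ ∈ Ts → ¬ ScalesInto (proj₁ x) T′
      from-triangle b sgn (c , 0<c , T , props , f∈ , g∈ , h∈) =
        (T , props) , λ {T′} → avoids⇒not-scaled Ts b {u} {v} {c} {T} {T′} sgn 0<c f∈ g∈ h∈ avoids
      from-sign : (∃ λ b → HasSign N b u) → Σ IntegerTriangle λ x → ∀ {T′} → T′ ∈ Ts → ¬ ScalesInto (proj₁ x) T′
      from-sign (b , sgn) = from-triangle b sgn
        (scaled-signedTriangle (sides-satisfyRatio N b on) (sides-nonDegenerate Ts b sgn on avoids))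

    not-scaled⇒dissimilar : ∀ xs → (Σ IntegerTriangle λ x → ∀ {T′} → T′ ∈ map proj₁ xs → ¬ ScalesInto (proj₁ x) T′) →
                            ∃ λ x → ∀ {y} → y ∈ xs → ¬ (Similar x y ⊎ Similar y x)
    not-scaled⇒dissimilar xs (x , not-scaled) = x , dissimilar
      where
      dissimilar : ∀ {y} → y ∈ xs → ¬ (Similar x y ⊎ Similar y x)
      dissimilar {y} y∈xs (inj₁ x∼y) = not-scaled (∈-map⁺ proj₁ y∈xs) (∼⇒ScalesInto {proj₁ x} {proj₁ y} x∼y)
      dissimilar {y} y∈xs (inj₂ y∼x) = not-scaled (∈-map⁺ proj₁ y∈xs) (∼⇒ScalesInto˘ {proj₁ y} {proj₁ x} y∼x)

    next-triangle : (Σ (ℕ → ℚ × ℚ) λ p → (∀ n → OnCurve (𝓔 N) (proj₁ (p n)) (proj₂ (p n))) × Injective _≡_ _≡_ p) →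
                    (xs : List IntegerTriangle) →
                    ∃ λ x → ∀ {y} → y ∈ xs → ¬ (Similar x y ⊎ Similar y x)
    next-triangle (p , on , p-injective) xs = select
      (fresh matches? p (λ κ {m} {n} M M′ → p-injective (matches-unique κ (on m) (on n) M M′)) (keysOf (map proj₁ xs)) 0)
      where
      select : (∃ λ n → 0 ℕ.≤ n × (∀ {κ} → κ ∈ keysOf (map proj₁ xs) → ¬ Matches κ (p n))) →
               ∃ λ x → ∀ {y} → y ∈ xs → ¬ (Similar x y ⊎ Similar y x)
      select (n , _ , avoids) = not-scaled⇒dissimilar xs (new-triangle (map proj₁ xs) (on n) avoids)

    -- One sequence of integer triangles serves both conclusions.
    dissimilar-sequence : (T : ℕ → IntegerTriangle) → Injective _≡_ Similar T →
                          InfinitelyManyTriangles (λ T → R/r T ≡ N) ×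
                          InfinitelyManyTriangles (λ T → IsIntegerTriangle T × R/r T ≡ N)
    dissimilar-sequence T T-injective =
      ((λ n → proj₁ (T n)) , (λ n → proj₂ (proj₂ (T n))) , T-injective) ,
      ((λ n → proj₁ (T n)) , (λ n → proj₂ (T n)) , T-injective)

    infinitely-many-triangles : ((xs : List IntegerTriangle) → ∃ λ x → ∀ {y} → y ∈ xs → ¬ (Similar x y ⊎ Similar y x)) →
                                InfinitelyManyTriangles (λ T → R/r T ≡ N) ×
                                InfinitelyManyTriangles (λ T → IsIntegerTriangle T × R/r T ≡ N)
    infinitely-many-triangles next = dissimilar-sequence (greedy {_≈_ = Similar} next) (greedy-injective {_≈_ = Similar} next)

corollary10 : (N : ℚ) → + 1 / 4 < N → HasPositiveRank (𝓔 N) →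
    InfinitelyManyTriangles (λ T → R/r T ≡ N) ×
    InfinitelyManyTriangles (λ T → IsIntegerTriangle T × R/r T ≡ N)
corollary10 N 1/4<N positive-rank = infinitely-many-triangles N 1/4<N
  (next-triangle N 1/4<N (infinitely-many-points (𝓔 N) positive-rank))
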